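{- Let $n\ge1$, let $S^0=S^0_{111}$ be the TASEP and $X^0=X^0_{111}$ the complete chain defined below, and suppose the initial distributions satisfy that $S^0(0)$ and $\mathrm{top}(X^0(0))$ have the same law. Then for every TASEP configuration $\tau$ of length $n$ and every $t\ge0$, $\mathrm{Prob}(S^0(t)=\tau)=\mathrm{Prob}(\mathrm{top}(X^0(t))=\tau)$, and $$\mathrm{Prob}(S^0(t)=\tau)\xrightarrow[t\to\infty]{}\frac{|\{\omega\in\Omega^0_n:\mathrm{top}(\omega)=\tau\}|}{|\Omega^0_n|}.$$ In particular, for all $k,m\ge0$ with $k+m=n$, $$\mathrm{Prob}(S^0(t)\text{ contains }k\text{ black and }m\text{ white particles})\xrightarrow[t\to\infty]{}\frac{|\Omega^0_{k,m}|}{|\Omega^0_n|}=\frac{\frac{1}{n+1}\binom{n+1}{k}\binom{n+1}{m}}{C_{n+1}},$$ where $C_{n+1}=\frac{1}{n+2}\binom{2n+2}{n+1}$.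
   Context: A TASEP configuration of length $n$ is a row of $n$ cells each containing a black ($\bullet$) or white ($\circ$) particle; cells are numbered $1,\dots,n$ and walls $0,\dots,n$, wall $i$ between cells $i$ and $i+1$ (wall $0$ = left border, wall $n$ = right border). For $\alpha,\beta,\gamma\in\,]0,1]$ the TASEP $S^0_{\alpha\beta\gamma}$ is the Markov chain: at each step choose a wall $i$ uniformly in $\{0,\dots,n\}$; with probability $\lambda(i)$ (where $\lambda(i)=\alpha$ for $1\le i\le n-1$, $\lambda(0)=\beta$, $\lambda(n)=\gamma$) apply: if $1\le i\le n-1$ and cells $i,i+1$ contain $\bullet,\circ$, swap them; if $i=0$ and cell $1$ contains $\circ$, replace it by $\bullet$; if $i=n$ and cell $n$ contains $\bullet$, replace it by $\circ$; otherwise nothing changes. With the complementary probability nothing changes. A complete configuration of length $n$ is a pair of rows (top, bottom) of $n$ cells, each with a black or white particle, such that the two rows together contain $n$ black and $n$ white particles and for every $j$ the first $j$ columns contain at least as many black as white particles; $\Omega^0_n$ is their set, $\mathrm{top}(\omega)$ is the top row of $\omega$, and $\Omega^0_{k,m}$ is the set of $\omega\in\Omega^0_n$ with $k$ black and $m$ white particles in the top row. Columns are numbered $1,\dots,n$, wall $i$ between columns $i$ and $i+1$; $t_c,b_c$ are the top and bottom particles of column $c$. The map $T:\Omega^0_n\times\{0,\dots,n\}\to\Omega^0_n$ is defined by cases (unmentioned particles keep their relative order in their row): (a') $1\le i\le n-1$, $t_i=\bullet$, $t_{i+1}=\circ$, $b_{i+1}=\bullet$: with $j_1$ the smallest $j\in\{0,\dots,i-1\}$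 such that $t_{j+1},\dots,t_{i-1}$ are white, remove column $i+1$ and reinsert it as column $j_1+1$. (a'') $1\le i\le n-1$, $t_i=\bullet$, $t_{i+1}=\circ$, $b_{i+1}=\circ$: with $j_2$ the largest $j\in\{i+1,\dots,n\}$ such that $t_{i+2},\dots,t_j$ are black, delete $t_i$ and insert a black particle as top cell $j_2$; delete $b_{i+1}$ and insert a white particle as bottom cell $j_2+1$ if $j_2<n$, bottom cell $n$ if $j_2=n$. (b) $i=0$, $t_1=\circ$: with $j_2$ the largest $j\in\{1,\dots,n\}$ such that $t_2,\dots,t_j$ are black, delete column $1$, insert a black particle as top cell $j_2$ and a white particle as bottom cell $j_2+1$ if $j_2<n$, bottom cell $n$ if $j_2=n$. (c) $i=n$, $t_n=\bullet$: with $j_1$ the smallest $j\in\{0,\dots,n-1\}$ such that $t_{j+1},\dots,t_{n-1}$ are white, delete column $n$ and insert a column ($\circ$ on top, $\bullet$ below) as column $j_1+1$. (d) otherwise $T(\omega,i)=\omega$. The chain $X^0_{\alpha\beta\gamma}$ on $\Omega^0_n$: at each step choose $i$ uniformly in $\{0,\dots,n\}$; the next state is $T(X^0_{\alpha\beta\gamma}(t),i)$ with probability $\lambda(i)$ and the current state otherwise. $S^0=S^0_{111}$, $X^0=X^0_{111}$.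
   Formalization: The initial distributions of S⁰(0) and X⁰(0) are taken to have rational probabilities, where the statement allows arbitrary real ones. -}

module Defs where

open import Data.Bool using (Bool; true; false; not; _∧_; if_then_else_)
open import Data.Nat as ℕ using (ℕ; zero; suc; _+_; _∸_; _≤ᵇ_; _<ᵇ_; _≡ᵇ_)
open import Data.Nat.Combinatorics using (_C_)
open import Data.Integer using (+_)
open import Data.List using (List; []; _∷_; length; filter; map; foldr; concatMap; applyUpTo; reverse)
import Data.List
open import Data.List.Properties using (≡-dec)
open import Data.Product using (_×_; _,_; proj₁; proj₂; ∃)
open import Data.Product.Properties using () renaming (≡-dec to ×-≡-dec)
import Data.Bool.Properties as BoolP
open import Data.Rational using (ℚ; 0ℚ; 1ℚ; _/_; _÷_; _*_; _-_; ∣_∣; _<_; _≤_; ≢-nonZero)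
import Data.Rational as Q
import Data.Rational.Properties as QP
open import Relation.Nullary using (yes; no; does)
open import Relation.Binary.PropositionalEquality using (_≡_)

-- Particles: true = black (•), false = white (∘).
-- A row / TASEP configuration of length n is a List Bool of length n.

Row : Set
Row = List Bool

rows : ℕ → List Row
rows zero = [] ∷ []
rows (suc n) = concatMap (λ r → (true ∷ r) ∷ (false ∷ r) ∷ []) (rows n)

boolFilter : {A : Set} → (A → Bool) → List A → List A
boolFilter p [] = []
boolFilter p (x ∷ xs) = if p x then x ∷ boolFilter p xs else boolFilter p xs

all : {A : Set} → (A → Bool) → List A → Bool
all p [] = true
all p (x ∷ xs) = p x ∧ all p xs

-- 1-indexed cell access (default white outside range; only used in range)
get : Row → ℕ → Bool
get [] _ = false
get (x ∷ xs) zero = false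
get (x ∷ xs) (suc zero) = x
get (x ∷ xs) (suc (suc c)) = get xs (suc c)

-- 0-indexed list surgery
setAt : {A : Set} → ℕ → A → List A → List A
setAt _ _ [] = []
setAt zero a (x ∷ xs) = a ∷ xs
setAt (suc k) a (x ∷ xs) = x ∷ setAt k a xs

removeAt : {A : Set} → ℕ → List A → List A
removeAt _ [] = []
removeAt zero (x ∷ xs) = xs
removeAt (suc k) (x ∷ xs) = x ∷ removeAt k xs

insertAt : {A : Set} → ℕ → A → List A → List A
insertAt zero a xs = a ∷ xs
insertAt (suc k) a [] = a ∷ []
insertAt (suc k) a (x ∷ xs) = x ∷ insertAt k a xs

-- the list a, a+1, ..., b (empty if b < a)
range : ℕ → ℕ → List ℕ
range a b = applyUpTo (λ k → a + k) (suc b ∸ a)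

-- cells a..b of t are all white / all black (vacuous if b < a)
allWhite : Row → ℕ → ℕ → Bool
allWhite t a b = all (λ c → not (get t c)) (range a b)

allBlack : Row → ℕ → ℕ → Bool
allBlack t a b = all (λ c → get t c) (range a b)

-- smallest j in {lo..hi} with p j (hi if none)
smallest : (ℕ → Bool) → ℕ → ℕ → ℕ
smallest p lo hi = go (range lo hi)
  where
  go : List ℕ → ℕ
  go [] = hi
  go (j ∷ js) = if p j then j else go js

-- largest j in {lo..hi} with p j (lo if none)
largest : (ℕ → Bool) → ℕ → ℕ → ℕ
largest p lo hi = go (reverse (range lo hi))
  where
  go : List ℕ → ℕ
  go [] = lo
  go (j ∷ js) = if p j then j else go js

count : {A : Set} → (A → Bool) → List A → ℕ
count p xs = length (boolFilter p xs)

blacks whites : Row → ℕ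
blacks r = count (λ x → x) r
whites r = count not r

-- TASEP single-step map (wall i, applied when the wall "fires")

tasepMove : ℕ → Row → ℕ → Row
tasepMove n τ zero = if not (get τ 1) then setAt 0 true τ else τ
tasepMove n τ (suc i) =
  if suc i ≡ᵇ n
  then (if get τ n then setAt (n ∸ 1) false τ else τ)
  else (if get τ (suc i) ∧ not (get τ (suc (suc i)))
        then setAt i false (setAt (suc i) true τ) else τ)

Conf : Set
Conf = Row × Row

top : Conf → Row
top = proj₁

prefixOK : Conf → ℕ → Bool
prefixOK (t , b) j =
  let tt = Data.List.take j t ; bb = Data.List.take j b in
  (whites tt + whites bb) ≤ᵇ (blacks tt + blacks bb)

isComplete : ℕ → Conf → Bool
isComplete n (t , b) =
  (length t ≡ᵇ n) ∧ (length b ≡ᵇ n) ∧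
  ((blacks t + blacks b) ≡ᵇ n) ∧ ((whites t + whites b) ≡ᵇ n) ∧
  all (prefixOK (t , b)) (range 0 n)

Ω : ℕ → List Conf
Ω n = boolFilter (isComplete n) (concatMap (λ t → map (λ b → (t , b)) (rows n)) (rows n))

Ωkm : ℕ → ℕ → ℕ → List Conf
Ωkm n k m = boolFilter (λ ω → (blacks (top ω) ≡ᵇ k) ∧ (whites (top ω) ≡ᵇ m)) (Ω n)

-- the map T (cells/columns 1-indexed; setAt/removeAt/insertAt 0-indexed)
Tmap : ℕ → Conf → ℕ → Conf
Tmap n (t , b) zero =
  if not (get t 1)
  then (let j₂ = largest (λ j → allBlack t 2 j) 1 n
            bpos = if j₂ <ᵇ n then j₂ else n ∸ 1 in
        ( insertAt (j₂ ∸ 1) true (removeAt 0 t)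
        , insertAt bpos false (removeAt 0 b)))
  else (t , b)
Tmap n (t , b) (suc i) =
  if suc i ≡ᵇ n
  then (if get t n
        then (let j₁ = smallest (λ j → allWhite t (suc j) (n ∸ 1)) 0 (n ∸ 1) in
              ( insertAt j₁ false (removeAt (n ∸ 1) t)
              , insertAt j₁ true (removeAt (n ∸ 1) b)))
        else (t , b))
  else (if get t (suc i) ∧ not (get t (suc (suc i)))
        then (if get b (suc (suc i))
              then (let j₁ = smallest (λ j → allWhite t (suc j) i) 0 i in
                    ( insertAt j₁ (get t (suc (suc i))) (removeAt (suc i) t)
                    , insertAt j₁ (get b (suc (suc i))) (removeAt (suc i) b)))
              else (let j₂ = largest (λ j → allBlack t (suc (suc (suc i))) j) (suc (suc i)) n
                        bpos = if j₂ <ᵇ n then j₂ else n ∸ 1 in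
                    ( insertAt (j₂ ∸ 1) true (removeAt i t)
                    , insertAt bpos false (removeAt (suc i) b))))
        else (t , b))

Σ[_]_ : {A : Set} → List A → (A → ℚ) → ℚ
Σ[ xs ] f = foldr (λ x acc → f x Q.+ acc) 0ℚ xs

ind : Bool → ℚ
ind true = 1ℚ
ind false = 0ℚ

rate : ℕ → ℚ → ℚ → ℚ → ℕ → ℚ
rate n α β γ zero = β
rate n α β γ (suc i) = if suc i ≡ᵇ n then γ else α

-- one step of the law: choose wall i uniformly in {0..n}; with prob λ(i) move by f
stepLaw : {S : Set} → (S → S → Bool) → List S → (S → ℕ → S) →
          ℕ → (ℕ → ℚ) → (S → ℚ) → (S → ℚ)
stepLaw eq space f n lam P y =
  (+ 1 / suc n) * Σ[ range 0 n ] (λ i → Σ[ space ] (λ x →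
      P x * (lam i * ind (eq (f x i) y) Q.+ (1ℚ - lam i) * ind (eq x y))))

iter : {S : Set} → ℕ → ((S → ℚ) → (S → ℚ)) → (S → ℚ) → (S → ℚ)
iter zero F P = P
iter (suc t) F P = F (iter t F P)

rowEq : Row → Row → Bool
rowEq r s = does (≡-dec BoolP._≟_ r s)

confEq : Conf → Conf → Bool
confEq ω ω' = does (×-≡-dec (≡-dec BoolP._≟_) (≡-dec BoolP._≟_) ω ω')

lawS : ℕ → ℚ → ℚ → ℚ → (Row → ℚ) → ℕ → Row → ℚ
lawS n α β γ μ t = iter t (stepLaw rowEq (rows n) (tasepMove n) n (rate n α β γ)) μ

lawX : ℕ → ℚ → ℚ → ℚ → (Conf → ℚ) → ℕ → Conf → ℚ
lawX n α β γ μ t = iter t (stepLaw confEq (Ω n) (Tmap n) n (rate n α β γ)) μ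

topLaw : ℕ → (Conf → ℚ) → Row → ℚ
topLaw n P τ = Σ[ Ω n ] (λ ω → P ω * ind (rowEq (top ω) τ))

IsDistribution : {S : Set} → List S → (S → ℚ) → Set
IsDistribution {S} space μ =
  ((x : S) → Data.List.Membership.Propositional._∈_ x space → 0ℚ ≤ μ x) × (Σ[ space ] μ ≡ 1ℚ)
  where import Data.List.Membership.Propositional

_⟶_ : (ℕ → ℚ) → ℚ → Set
p ⟶ L = (ε : ℚ) → 0ℚ < ε → ∃ λ N → (t : ℕ) → N ℕ.≤ t → ∣ p t - L ∣ < ε

-- total division (q = 0 gives 0; only used with q ≠ 0)
_÷'_ : ℚ → ℚ → ℚ
p ÷' q with q Q.≟ 0ℚ
... | yes _ = 0ℚ
... | no q≢0 = _÷_ p q {{≢-nonZero q≢0}}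

ℕtoℚ : ℕ → ℚ
ℕtoℚ k = + k / 1

catalanSucc : ℕ → ℚ
catalanSucc n = (+ 1 / suc (suc n)) * ℕtoℚ ((2 ℕ.* n + 2) C (n + 1))

{-# OPTIONS --safe #-}
-- T maps complete configurations to complete configurations and lies over the TASEP move on the top
-- row, so top(X⁰) and S⁰ have the same law.  The number w 0 τ of complete configurations with top row τ
-- satisfies the matrix-product relations DE = D + E, ⟨W|E = ⟨W|, D|V⟩ = |V⟩, because a column changes
-- the height of the walk by +1, 0 or −1; these relations make w 0 stationary by a telescoping argument.
-- For the convergence, the transpose of the transition operator averages a function over the n + 1
-- walls.  Every row reaches the full row in a fixed number M of steps, with probability at least
-- (n + 1)^−M, so M averagings shrink the oscillation of a function by a fixed factor.
-- The counts follow from the reflection principle: a two-row walk with k black particles on top is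
-- counted by C(n,k)² − C(n,k−1) C(n,k+1), and all walks by C(2n,n) − C(2n,n+2).
module Submission where

-- Limits are taken on rows only: `T` has to lie over the TASEP, and the uniform weight on complete
-- configurations enters through its top marginal, whose invariance is checked directly and not
-- through the complete chain. Laws are functions on all lists, also on those outside the state
-- space. They are therefore treated as functionals: each statement about a law is a sum over the
-- state space against an arbitrary test function, and a time step passes from the law to the test
-- function as an average. Both sides of the limit then become means of one and the same averaged
-- function, so it is enough that its values lie in a short interval. The matrix relations have a
-- short source. If U and L raise and lower the starting height of the walk by one, then D = 1 + U
-- and E = 1 + L. A rise followed by a fall is always allowed, so UL = 1 and DE = 1 + U + L + 1 = D
-- + E. A fall from height 0 is forbidden, which gives the left-wall relation; the walk must end at
-- height 0, which gives the right-wall relation.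

open import Defs
open import Data.Bool using (Bool; true; false; not; _∧_; if_then_else_; T)
import Data.Bool.Properties as BoolP
open import Data.Empty using (⊥-elim)
import Data.Integer as ℤ
import Data.Integer.Properties as ℤP
open import Data.List using (List; []; _∷_; length; map; concatMap; take; _++_; applyUpTo; upTo; replicate; reverse; applyDownFrom)
import Data.List.Properties as ListP
open import Data.List.Membership.Propositional using (_∈_; find)
import Data.List.Membership.Propositional.Properties as ∈P
open import Data.List.Relation.Unary.Any as Any using (here; there)
open import Data.Nat as ℕ using (ℕ; zero; suc; z≤n; s≤s; _≡ᵇ_; _<ᵇ_)
open import Data.Nat.Combinatorics as CP using (_C_)
import Data.Nat.Properties as ℕP
import Data.Nat.Tactic.RingSolver as ℕRing
open import Data.Product using (_×_; _,_; proj₁; proj₂; ∃)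
open import Data.Rational
  using (ℚ; mkℚ; 0ℚ; 1ℚ; _/_; 1/_; _+_; _*_; _-_; -_; ∣_∣; _<_; _≤_; ≢-nonZero; toℚᵘ; positive; nonNegative)
import Data.Rational.Properties as ℚP
open import Data.Rational.Unnormalised as ℚᵘ using (mkℚᵘ; *≡*)
import Data.Rational.Unnormalised.Properties as ℚᵘP
open import Data.Sum using (_⊎_; inj₁; inj₂)
open import Function using (_∘_)
open import Function.Bundles using (Equivalence)
open import Relation.Binary.PropositionalEquality
  using (_≡_; _≢_; refl; sym; trans; cong; cong₂; subst; subst₂; module ≡-Reasoning)
open import Relation.Nullary using (yes; no)
open import Relation.Nullary.Decidable using (dec⇒maybe)
open import Tactic.RingSolver using (solve-∀)
open import Tactic.RingSolver.Core.AlmostCommutativeRing using (AlmostCommutativeRing; fromCommutativeRing)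

ℚ-ring : AlmostCommutativeRing _ _
ℚ-ring = fromCommutativeRing ℚP.+-*-commutativeRing (λ p → dec⇒maybe (0ℚ ℚP.≟ p))

variable
  A B : Set

-- Finite sums of rationals

Σ-cong-∈ : (xs : List A) {f g : A → ℚ} → (∀ x → x ∈ xs → f x ≡ g x) → Σ[ xs ] f ≡ Σ[ xs ] g
Σ-cong-∈ [] e = refl
Σ-cong-∈ (x ∷ xs) e = cong₂ _+_ (e x (here refl)) (Σ-cong-∈ xs (λ y y∈ → e y (there y∈)))

Σ-cong : (xs : List A) {f g : A → ℚ} → (∀ x → f x ≡ g x) → Σ[ xs ] f ≡ Σ[ xs ] g
Σ-cong xs e = Σ-cong-∈ xs (λ x _ → e x)

Σ-0 : (xs : List A) → Σ[ xs ] (λ _ → 0ℚ) ≡ 0ℚ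
Σ-0 [] = refl
Σ-0 (x ∷ xs) = trans (ℚP.+-identityˡ _) (Σ-0 xs)

+-interchange : ∀ a b c d → (a + b) + (c + d) ≡ (a + c) + (b + d)
+-interchange = solve-∀ ℚ-ring

Σ-+ : (xs : List A) (f g : A → ℚ) → Σ[ xs ] (λ x → f x + g x) ≡ Σ[ xs ] f + Σ[ xs ] g
Σ-+ [] f g = refl
Σ-+ (x ∷ xs) f g = trans (cong ((f x + g x) +_) (Σ-+ xs f g)) (+-interchange (f x) (g x) (Σ[ xs ] f) (Σ[ xs ] g))

Σ-*ˡ : (xs : List A) (c : ℚ) (f : A → ℚ) → Σ[ xs ] (λ x → c * f x) ≡ c * Σ[ xs ] f
Σ-*ˡ [] c f = sym (ℚP.*-zeroʳ c)
Σ-*ˡ (x ∷ xs) c f = trans (cong ((c * f x) +_) (Σ-*ˡ xs c f)) (sym (ℚP.*-distribˡ-+ c _ _))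

Σ-*ʳ : (xs : List A) (c : ℚ) (f : A → ℚ) → Σ[ xs ] (λ x → f x * c) ≡ Σ[ xs ] f * c
Σ-*ʳ xs c f = trans (Σ-cong xs (λ x → ℚP.*-comm (f x) c)) (trans (Σ-*ˡ xs c f) (ℚP.*-comm c _))

Σ-swap : (xs : List A) (ys : List B) (f : A → B → ℚ) →
         Σ[ xs ] (λ x → Σ[ ys ] (f x)) ≡ Σ[ ys ] (λ y → Σ[ xs ] (λ x → f x y))
Σ-swap [] ys f = sym (Σ-0 ys)
Σ-swap (x ∷ xs) ys f =
  trans (cong (Σ[ ys ] (f x) +_) (Σ-swap xs ys f)) (sym (Σ-+ ys (f x) (λ y → Σ[ xs ] (λ x → f x y))))

Σ-++ : (xs ys : List A) (f : A → ℚ) → Σ[ xs ++ ys ] f ≡ Σ[ xs ] f + Σ[ ys ] f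
Σ-++ [] ys f = sym (ℚP.+-identityˡ _)
Σ-++ (x ∷ xs) ys f = trans (cong (f x +_) (Σ-++ xs ys f)) (sym (ℚP.+-assoc (f x) _ _))

Σ-map : (h : A → B) (xs : List A) (f : B → ℚ) → Σ[ map h xs ] f ≡ Σ[ xs ] (f ∘ h)
Σ-map h [] f = refl
Σ-map h (x ∷ xs) f = cong (f (h x) +_) (Σ-map h xs f)

Σ-concatMap : (h : A → List B) (xs : List A) (f : B → ℚ) →
              Σ[ concatMap h xs ] f ≡ Σ[ xs ] (λ x → Σ[ h x ] f)
Σ-concatMap h [] f = refl
Σ-concatMap h (x ∷ xs) f = trans (Σ-++ (h x) _ f) (cong (Σ[ h x ] f +_) (Σ-concatMap h xs f))

Σ-filter : (p : A → Bool) (xs : List A) (f : A → ℚ) →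
           Σ[ boolFilter p xs ] f ≡ Σ[ xs ] (λ x → ind (p x) * f x)
Σ-filter p [] f = refl
Σ-filter p (x ∷ xs) f with p x
... | true = cong₂ _+_ (sym (ℚP.*-identityˡ (f x))) (Σ-filter p xs f)
... | false = trans (Σ-filter p xs f)
  (trans (sym (ℚP.+-identityˡ _)) (cong (_+ _) (sym (ℚP.*-zeroˡ (f x)))))

Σ-mono-≤ : (xs : List A) {f g : A → ℚ} → (∀ x → x ∈ xs → f x ≤ g x) → Σ[ xs ] f ≤ Σ[ xs ] g
Σ-mono-≤ [] e = ℚP.≤-refl
Σ-mono-≤ (x ∷ xs) e = ℚP.+-mono-≤ (e x (here refl)) (Σ-mono-≤ xs (λ y y∈ → e y (there y∈)))

ind-∧ : ∀ a b → ind (a ∧ b) ≡ ind a * ind b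
ind-∧ true b = sym (ℚP.*-identityˡ _)
ind-∧ false b = sym (ℚP.*-zeroˡ (ind b))

0≤ind : ∀ b → 0ℚ ≤ ind b
0≤ind true = ℚP.nonNegative⁻¹ 1ℚ
0≤ind false = ℚP.≤-refl

ind≤1 : ∀ b → ind b ≤ 1ℚ
ind≤1 true = ℚP.≤-refl
ind≤1 false = ℚP.nonNegative⁻¹ 1ℚ

-- Natural numbers inside the rationals, and total division

toℚᵘ-/ : ∀ k d → toℚᵘ (ℤ.+ k / suc d) ℚᵘ.≃ mkℚᵘ (ℤ.+ k) d
toℚᵘ-/ k d = ℚP.toℚᵘ-fromℚᵘ (mkℚᵘ (ℤ.+ k) d)

-- `_/_` divides by a gcd, which does not compute on variables. The identities are therefore checked
-- on unnormalised fractions, where they become identities of integers.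
ℕtoℚ-+ : ∀ a b → ℕtoℚ (a ℕ.+ b) ≡ ℕtoℚ a + ℕtoℚ b
ℕtoℚ-+ a b = ℚP.toℚᵘ-injective (ℚᵘP.≃-trans (toℚᵘ-/ (a ℕ.+ b) 0)
  (ℚᵘP.≃-sym (ℚᵘP.≃-trans (ℚP.toℚᵘ-homo-+ (ℕtoℚ a) (ℕtoℚ b))
    (ℚᵘP.≃-trans (ℚᵘP.+-cong (toℚᵘ-/ a 0) (toℚᵘ-/ b 0))
      (*≡* (cong (ℤ._* (ℤ.+ 1)) (cong₂ ℤ._+_ (ℤP.*-identityʳ (ℤ.+ a)) (ℤP.*-identityʳ (ℤ.+ b)))))))))

ℕtoℚ-* : ∀ a b → ℕtoℚ (a ℕ.* b) ≡ ℕtoℚ a * ℕtoℚ b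
ℕtoℚ-* a b = ℚP.toℚᵘ-injective (ℚᵘP.≃-trans (toℚᵘ-/ (a ℕ.* b) 0)
  (ℚᵘP.≃-sym (ℚᵘP.≃-trans (ℚP.toℚᵘ-homo-* (ℕtoℚ a) (ℕtoℚ b))
    (ℚᵘP.≃-trans (ℚᵘP.*-cong (toℚᵘ-/ a 0) (toℚᵘ-/ b 0))
      (*≡* (cong (ℤ._* (ℤ.+ 1)) (sym (ℤP.pos-* a b))))))))

ℕtoℚ-suc : ∀ n → ℕtoℚ (suc n) ≡ 1ℚ + ℕtoℚ n
ℕtoℚ-suc n = ℕtoℚ-+ 1 n

1/suc*suc : ∀ n → (ℤ.+ 1 / suc n) * ℕtoℚ (suc n) ≡ 1ℚ
1/suc*suc n = ℚP.toℚᵘ-injective (ℚᵘP.≃-trans (ℚP.toℚᵘ-homo-* (ℤ.+ 1 / suc n) (ℕtoℚ (suc n)))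
  (ℚᵘP.≃-trans (ℚᵘP.*-cong (toℚᵘ-/ 1 n) (toℚᵘ-/ (suc n) 0))
    (*≡* (trans (ℤP.*-identityʳ _) (trans (ℤP.*-identityˡ (ℤ.+ suc n))
      (sym (trans (ℤP.*-identityˡ _) (cong ℤ.+_ (ℕP.*-identityʳ (suc n))))))))))

0<1/suc : ∀ n → 0ℚ < (ℤ.+ 1 / suc n)
0<1/suc n = ℚP.positive⁻¹ (ℤ.+ 1 / suc n) {{ℚP.normalize-pos 1 (suc n)}}

0≤ℕtoℚ : ∀ n → 0ℚ ≤ ℕtoℚ n
0≤ℕtoℚ n = ℚP.nonNegative⁻¹ (ℕtoℚ n) {{ℚP.normalize-nonNeg n 1}}

Σ-const : (xs : List A) (c : ℚ) → Σ[ xs ] (λ _ → c) ≡ ℕtoℚ (length xs) * c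
Σ-const [] c = sym (ℚP.*-zeroˡ c)
Σ-const (x ∷ xs) c = trans (cong (c +_) (Σ-const xs c))
  (trans (distrib-suc c (ℕtoℚ (length xs))) (cong (_* c) (sym (ℕtoℚ-suc (length xs)))))
  where
  distrib-suc : ∀ c l → c + l * c ≡ (1ℚ + l) * c
  distrib-suc = solve-∀ ℚ-ring

length-filter : (p : A → Bool) (xs : List A) → ℕtoℚ (length (boolFilter p xs)) ≡ Σ[ xs ] (ind ∘ p)
length-filter p xs =
  trans (sym (trans (Σ-const (boolFilter p xs) 1ℚ) (ℚP.*-identityʳ _)))
    (trans (Σ-filter p xs (λ _ → 1ℚ)) (Σ-cong xs (λ x → ℚP.*-identityʳ (ind (p x)))))

÷'-unique : ∀ p q r → q ≢ 0ℚ → r * q ≡ p → p ÷' q ≡ r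
÷'-unique p q r q≢0 e with q ℚP.≟ 0ℚ
... | yes q≡0 = ⊥-elim (q≢0 q≡0)
... | no q≢0′ = trans (cong (_* 1/_ q {{≢-nonZero q≢0′}}) (sym e))
  (trans (ℚP.*-assoc r q _) (trans (cong (r *_) (ℚP.*-inverseʳ q {{≢-nonZero q≢0′}})) (ℚP.*-identityʳ r)))

÷'-* : ∀ p q → q ≢ 0ℚ → (p ÷' q) * q ≡ p
÷'-* p q q≢0 with q ℚP.≟ 0ℚ
... | yes q≡0 = ⊥-elim (q≢0 q≡0)
... | no q≢0′ = trans (ℚP.*-assoc p _ q) (trans (cong (p *_) (ℚP.*-inverseˡ q {{≢-nonZero q≢0′}})) (ℚP.*-identityʳ p))

*-mono-nonNeg : ∀ c {p q} → 0ℚ ≤ c → p ≤ q → c * p ≤ c * q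
*-mono-nonNeg c 0≤c p≤q = ℚP.*-monoˡ-≤-nonNeg c {{nonNegative 0≤c}} p≤q

0≤* : ∀ {p q} → 0ℚ ≤ p → 0ℚ ≤ q → 0ℚ ≤ p * q
0≤* {p} {q} 0≤p 0≤q = subst (_≤ p * q) (ℚP.*-zeroʳ p) (*-mono-nonNeg p 0≤p 0≤q)

-- Rows, and the dual of the one-step operator

Σ-upTo : ∀ n (F : ℕ → ℚ) → Σ[ upTo (suc n) ] F ≡ F 0 + Σ[ upTo n ] (F ∘ suc)
Σ-upTo n F = cong (F 0 +_) (trans (cong (λ xs → Σ[ xs ] F) (sym (ListP.map-upTo suc n))) (Σ-map suc (upTo n) F))

Σ-rows : ∀ n (F : Row → ℚ) → Σ[ rows (suc n) ] F ≡ Σ[ rows n ] (λ r → F (true ∷ r) + F (false ∷ r))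
Σ-rows n F = trans (Σ-concatMap (λ r → (true ∷ r) ∷ (false ∷ r) ∷ []) (rows n) F)
  (Σ-cong (rows n) (λ r → cong (F (true ∷ r) +_) (ℚP.+-identityʳ (F (false ∷ r)))))

∈-rows⁺ : ∀ r → r ∈ rows (length r)
∈-rows⁺ [] = here refl
∈-rows⁺ (x ∷ r) = ∈P.∈-concatMap⁺ (λ r → (true ∷ r) ∷ (false ∷ r) ∷ []) (Any.map (extend x) (∈-rows⁺ r))
  where
  extend : ∀ x {s} → r ≡ s → (x ∷ r) ∈ ((true ∷ s) ∷ (false ∷ s) ∷ [])
  extend true refl = here refl
  extend false refl = there (here refl)

∈-rows⁻ : ∀ n {r} → r ∈ rows n → length r ≡ n
∈-rows⁻ zero (here refl) = refl
∈-rows⁻ (suc n) {r} r∈ with find (∈P.∈-concatMap⁻ (λ r → (true ∷ r) ∷ (false ∷ r) ∷ []) {xs = rows n} r∈)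
... | s , s∈ , here refl = cong suc (∈-rows⁻ n s∈)
... | s , s∈ , there (here refl) = cong suc (∈-rows⁻ n s∈)

rowEq-sym : ∀ r s → rowEq r s ≡ rowEq s r
rowEq-sym [] [] = refl
rowEq-sym [] (y ∷ s) = refl
rowEq-sym (x ∷ r) [] = refl
rowEq-sym (true ∷ r) (true ∷ s) = rowEq-sym r s
rowEq-sym (true ∷ r) (false ∷ s) = refl
rowEq-sym (false ∷ r) (true ∷ s) = refl
rowEq-sym (false ∷ r) (false ∷ s) = rowEq-sym r s

Σ-rowEq : ∀ z (g : Row → ℚ) → Σ[ rows (length z) ] (λ y → ind (rowEq z y) * g y) ≡ g z
Σ-rowEq [] g = trans (ℚP.+-identityʳ _) (ℚP.*-identityˡ (g []))
Σ-rowEq (true ∷ z) g = trans (Σ-rows (length z) (λ y → ind (rowEq (true ∷ z) y) * g y))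
  (trans (Σ-cong (rows (length z)) (λ r → only-left (ind (rowEq z r) * g (true ∷ r)) (g (false ∷ r))))
    (Σ-rowEq z (g ∘ (true ∷_))))
  where
  only-left : ∀ a b → a + 0ℚ * b ≡ a
  only-left = solve-∀ ℚ-ring
Σ-rowEq (false ∷ z) g = trans (Σ-rows (length z) (λ y → ind (rowEq (false ∷ z) y) * g y))
  (trans (Σ-cong (rows (length z)) (λ r → only-right (ind (rowEq z r) * g (false ∷ r)) (g (true ∷ r))))
    (Σ-rowEq z (g ∘ (false ∷_))))
  where
  only-right : ∀ a b → 0ℚ * b + a ≡ a
  only-right = solve-∀ ℚ-ring

rate-1 : ∀ n i → rate n 1ℚ 1ℚ 1ℚ i ≡ 1ℚ
rate-1 n zero = refl
rate-1 n (suc i) with suc i ≡ᵇ n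
... | true = refl
... | false = refl

∈-range⁻ : ∀ {n i} → i ∈ range 0 n → i ℕ.≤ n
∈-range⁻ i∈ with ∈P.∈-applyUpTo⁻ (λ k → k) i∈
... | k , k<1+n , refl = ℕP.≤-pred k<1+n

average : {S : Set} → (S → ℕ → S) → ℕ → (S → ℚ) → S → ℚ
average f n g x = (ℤ.+ 1 / suc n) * Σ[ range 0 n ] (λ i → g (f x i))

-- `Δ` says that summing against `eq z` evaluates at `z`: it encodes that `eq` is equality and that
-- `space` lists each state exactly once.
module _ {S : Set} (eq : S → S → Bool) (space : List S) (f : S → ℕ → S) (n : ℕ)
  (Δ : ∀ z → z ∈ space → (g : S → ℚ) → Σ[ space ] (λ y → ind (eq z y) * g y) ≡ g z)
  (closed : ∀ x i → x ∈ space → i ℕ.≤ n → f x i ∈ space) where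

  private
    Σ-walls : (I : List ℕ) (lam : ℕ → ℚ) (c : ℚ) (P g : S → ℚ) →
      (∀ i → i ∈ I → i ℕ.≤ n) → (∀ i → lam i ≡ 1ℚ) →
      Σ[ space ] (λ y → (c * Σ[ I ] (λ i → Σ[ space ] (λ x →
        P x * (lam i * ind (eq (f x i) y) + (1ℚ - lam i) * ind (eq x y))))) * g y) ≡
      Σ[ space ] (λ x → P x * (c * Σ[ I ] (λ i → g (f x i))))
    Σ-walls I lam c P g I≤n lam≡1 = begin
      Σ[ space ] (λ y → (c * Σ[ I ] (λ i → Σ[ space ] (λ x →
        P x * (lam i * ind (eq (f x i) y) + (1ℚ - lam i) * ind (eq x y))))) * g y)
        -- At rate one the term for staying put has the factor `1ℚ - 1ℚ`.
        ≡⟨ Σ-cong space (λ y → cong (λ s → (c * s) * g y) (Σ-cong I (λ i → Σ-cong space (λ x →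
             simplify (P x) (lam i) (ind (eq (f x i) y)) (ind (eq x y)) (lam≡1 i))))) ⟩
      Σ[ space ] (λ y → (c * Σ[ I ] (λ i → Σ[ space ] (λ x → K x i y))) * g y)
        ≡⟨ Σ-cong space (λ y → trans (regroup c (Σ[ I ] (λ i → Σ[ space ] (λ x → K x i y))) (g y)) (cong (c *_)
             (trans (sym (Σ-*ʳ I (g y) (λ i → Σ[ space ] (λ x → K x i y))))
               (Σ-cong I (λ i → sym (Σ-*ʳ space (g y) (λ x → K x i y))))))) ⟩
      Σ[ space ] (λ y → c * Σ[ I ] (λ i → Σ[ space ] (λ x → K x i y * g y)))
        ≡⟨ Σ-*ˡ space c (λ y → Σ[ I ] (λ i → Σ[ space ] (λ x → K x i y * g y))) ⟩
      c * Σ[ space ] (λ y → Σ[ I ] (λ i → Σ[ space ] (λ x → K x i y * g y)))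
        ≡⟨ cong (c *_) (trans (Σ-swap space I (λ y i → Σ[ space ] (λ x → K x i y * g y)))
             (Σ-cong I (λ i → Σ-swap space space (λ y x → K x i y * g y)))) ⟩
      c * Σ[ I ] (λ i → Σ[ space ] (λ x → Σ[ space ] (λ y → K x i y * g y)))
        ≡⟨ cong (c *_) (Σ-cong-∈ I (λ i i∈ → Σ-cong-∈ space (λ x x∈ →
             trans (Σ-cong space (λ y → regroup (P x) (ind (eq (f x i) y)) (g y)))
               (trans (Σ-*ˡ space (P x) (λ y → ind (eq (f x i) y) * g y))
                 (cong (P x *_) (Δ (f x i) (closed x i x∈ (I≤n i i∈)) g)))))) ⟩
      c * Σ[ I ] (λ i → Σ[ space ] (λ x → P x * g (f x i)))
        ≡⟨ cong (c *_) (trans (Σ-swap I space (λ i x → P x * g (f x i)))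
             (Σ-cong space (λ x → Σ-*ˡ I (P x) (λ i → g (f x i))))) ⟩
      c * Σ[ space ] (λ x → P x * Σ[ I ] (λ i → g (f x i)))
        ≡⟨ sym (Σ-*ˡ space c (λ x → P x * Σ[ I ] (λ i → g (f x i)))) ⟩
      Σ[ space ] (λ x → c * (P x * Σ[ I ] (λ i → g (f x i))))
        ≡⟨ Σ-cong space (λ x → *-left-comm c (P x) (Σ[ I ] (λ i → g (f x i)))) ⟩
      Σ[ space ] (λ x → P x * (c * Σ[ I ] (λ i → g (f x i)))) ∎
      where
      open ≡-Reasoning
      K : S → ℕ → S → ℚ
      K x i y = P x * ind (eq (f x i) y)
      *-left-comm : ∀ a b c → a * (b * c) ≡ b * (a * c)
      *-left-comm = solve-∀ ℚ-ring
      regroup : ∀ c s g → (c * s) * g ≡ c * (s * g)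
      regroup = solve-∀ ℚ-ring
      firing : ∀ P a b → P * (1ℚ * a + (1ℚ - 1ℚ) * b) ≡ P * a
      firing = solve-∀ ℚ-ring
      simplify : ∀ P l a b → l ≡ 1ℚ → P * (l * a + (1ℚ - l) * b) ≡ P * a
      simplify P .1ℚ a b refl = firing P a b

  -- The one-step operator on laws is the transpose of averaging over the walls.
  stepLaw-dual : (P g : S → ℚ) →
    Σ[ space ] (λ y → stepLaw eq space f n (rate n 1ℚ 1ℚ 1ℚ) P y * g y) ≡
    Σ[ space ] (λ x → P x * average f n g x)
  stepLaw-dual P g =
    Σ-walls (range 0 n) (rate n 1ℚ 1ℚ 1ℚ) (ℤ.+ 1 / suc n) P g (λ i → ∈-range⁻) (rate-1 n)

-- mv τ i is the move at wall i + 1.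
mv : Row → ℕ → Row
mv [] _ = []
mv (x ∷ r) (suc i) = x ∷ mv r i
mv (true ∷ []) zero = false ∷ []
mv (false ∷ []) zero = false ∷ []
mv (true ∷ false ∷ r) zero = false ∷ true ∷ r
mv (true ∷ true ∷ r) zero = true ∷ true ∷ r
mv (false ∷ y ∷ r) zero = false ∷ y ∷ r

-- `tasepMove` works with positions and `mv` by recursion on the row. Behind a head `x` every
-- position shifts by one, so each branch of the nested tests is the branch for the tail with `x`
-- put in front.
tasepMove-suc : ∀ τ i → i ℕ.< length τ → tasepMove (length τ) τ (suc i) ≡ mv τ i
tasepMove-suc (true ∷ []) zero _ = refl
tasepMove-suc (false ∷ []) zero _ = refl
tasepMove-suc (true ∷ false ∷ r) zero _ = refl
tasepMove-suc (true ∷ true ∷ r) zero _ = refl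
tasepMove-suc (false ∷ y ∷ r) zero _ = refl
tasepMove-suc (x ∷ []) (suc i) (s≤s ())
tasepMove-suc (x ∷ σ@(y ∷ r)) (suc i) (s≤s i<) =
  trans (sym (trans (BoolP.if-float (x ∷_) (i ≡ᵇ length r))
          (cong₂ (λ a b → if i ≡ᵇ length r then a else b)
            (BoolP.if-float (x ∷_) (get σ (suc (length r))))
            (BoolP.if-float (x ∷_) (get σ (suc i) ∧ not (get σ (suc (suc i))))))))
    (cong (x ∷_) (tasepMove-suc σ i i<))

length-mv : ∀ τ i → length (mv τ i) ≡ length τ
length-mv [] i = refl
length-mv (true ∷ []) zero = refl
length-mv (false ∷ []) zero = refl
length-mv (true ∷ false ∷ r) zero = refl
length-mv (true ∷ true ∷ r) zero = refl
length-mv (false ∷ y ∷ r) zero = refl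
length-mv (x ∷ r) (suc i) = cong suc (length-mv r i)

length-tasepMove : ∀ τ i → i ℕ.≤ length τ → length (tasepMove (length τ) τ i) ≡ length τ
length-tasepMove [] zero _ = refl
length-tasepMove (true ∷ τ) zero _ = refl
length-tasepMove (false ∷ τ) zero _ = refl
length-tasepMove τ (suc i) i< = trans (cong length (tasepMove-suc τ i i<)) (length-mv τ i)

rows-closed : ∀ n τ i → τ ∈ rows n → i ℕ.≤ n → tasepMove n τ i ∈ rows n
rows-closed n τ i τ∈ i≤n with ∈-rows⁻ n τ∈
... | refl = subst (λ m → tasepMove n τ i ∈ rows m) (length-tasepMove τ i i≤n) (∈-rows⁺ (tasepMove n τ i))

rows-Δ : ∀ n z → z ∈ rows n → (g : Row → ℚ) → Σ[ rows n ] (λ y → ind (rowEq z y) * g y) ≡ g z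
rows-Δ n z z∈ g with ∈-rows⁻ n z∈
... | refl = Σ-rowEq z g

-- Stationarity

-- The matrix-product relations of the TASEP: DE = D + E in the bulk and D = 1 at the right wall.
record Ansatz (W : Row → ℚ) : Set where
  field
    bulk  : ∀ p r → W (p ++ true ∷ false ∷ r) ≡ W (p ++ true ∷ r) + W (p ++ false ∷ r)
    right : ∀ p → W (p ++ true ∷ []) ≡ W p

open Ansatz

-- Both relations hold behind any prefix, hence survive freezing the first cell; this drives the
-- induction in `Σ-drift`. The left-wall relation would not survive, so it is a separate hypothesis
-- of `stationary`.
ansatz-∷ : ∀ {W} x → Ansatz W → Ansatz (W ∘ (x ∷_))
ansatz-∷ x a .bulk p = bulk a (x ∷ p)
ansatz-∷ x a .right p = right a (x ∷ p)

-- The unnormalised generator of all walls except wall 0.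
drift : (Row → ℚ) → Row → ℚ
drift g τ = Σ[ upTo (length τ) ] (λ i → g (mv τ i) - g τ)

drift-∷ : ∀ g x σ → drift g (x ∷ σ) ≡ (g (mv (x ∷ σ) 0) - g (x ∷ σ)) + drift (g ∘ (x ∷_)) σ
drift-∷ g x σ = Σ-upTo (length σ) (λ i → g (mv (x ∷ σ) i) - g (x ∷ σ))

-- The weight of an exchange of • and ∘ is split by `bulk` into two boundary terms, one for each of
-- the two cells that remain. These cancel between neighbouring walls, `right` supplies the term at
-- the right wall, and only a term at the first cell survives.
Σ-drift : ∀ n {W} → Ansatz W → (g : Row → ℚ) →
  Σ[ rows (suc n) ] (λ τ → W τ * drift g τ) ≡ Σ[ rows n ] (λ r → W r * (g (false ∷ r) - g (true ∷ r)))
Σ-drift zero {W} a g = begin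
  W (true ∷ []) * ((g (false ∷ []) - g (true ∷ [])) + 0ℚ) + (W (false ∷ []) * ((g (false ∷ []) - g (false ∷ [])) + 0ℚ) + 0ℚ)
    ≡⟨ cong (λ w → w * ((g (false ∷ []) - g (true ∷ [])) + 0ℚ) + (W (false ∷ []) * ((g (false ∷ []) - g (false ∷ [])) + 0ℚ) + 0ℚ)) (right a []) ⟩
  W [] * ((g (false ∷ []) - g (true ∷ [])) + 0ℚ) + (W (false ∷ []) * ((g (false ∷ []) - g (false ∷ [])) + 0ℚ) + 0ℚ)
    ≡⟨ simplify (W []) (W (false ∷ [])) (g (false ∷ [])) (g (true ∷ [])) ⟩
  W [] * (g (false ∷ []) - g (true ∷ [])) + 0ℚ ∎
  where
  open ≡-Reasoning
  simplify : ∀ w v a b → w * ((a - b) + 0ℚ) + (v * ((a - a) + 0ℚ) + 0ℚ) ≡ w * (a - b) + 0ℚ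
  simplify = solve-∀ ℚ-ring
Σ-drift (suc n) {W} a g = begin
  Σ[ rows (suc (suc n)) ] F
    ≡⟨ Σ-rows (suc n) F ⟩
  Σ[ rows (suc n) ] (λ σ → F (true ∷ σ) + F (false ∷ σ))
    ≡⟨ Σ-rows n (λ σ → F (true ∷ σ) + F (false ∷ σ)) ⟩
  Σ[ rows n ] (λ r → (F (true ∷ true ∷ r) + F (false ∷ true ∷ r)) + (F (true ∷ false ∷ r) + F (false ∷ false ∷ r)))
    ≡⟨ Σ-cong (rows n) firstMove ⟩
  Σ[ rows n ] (λ r → ((H true (true ∷ r) + H true (false ∷ r)) + (H false (true ∷ r) + H false (false ∷ r))) + exchange r)
    ≡⟨ Σ-+ (rows n) (λ r → (H true (true ∷ r) + H true (false ∷ r)) + (H false (true ∷ r) + H false (false ∷ r))) exchange ⟩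
  Σ[ rows n ] (λ r → (H true (true ∷ r) + H true (false ∷ r)) + (H false (true ∷ r) + H false (false ∷ r))) + Σ[ rows n ] exchange
    ≡⟨ cong (_+ Σ[ rows n ] exchange) (trans
         (Σ-+ (rows n) (λ r → H true (true ∷ r) + H true (false ∷ r)) (λ r → H false (true ∷ r) + H false (false ∷ r)))
         (cong₂ _+_ (sym (Σ-rows n (H true))) (sym (Σ-rows n (H false))))) ⟩
  (Σ[ rows (suc n) ] (H true) + Σ[ rows (suc n) ] (H false)) + Σ[ rows n ] exchange
    ≡⟨ cong (_+ Σ[ rows n ] exchange) (cong₂ _+_
         (Σ-drift n (ansatz-∷ true a) (g ∘ (true ∷_))) (Σ-drift n (ansatz-∷ false a) (g ∘ (false ∷_)))) ⟩
  (Σ[ rows n ] (R true) + Σ[ rows n ] (R false)) + Σ[ rows n ] exchange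
    ≡⟨ cong (_+ Σ[ rows n ] exchange) (sym (Σ-+ (rows n) (R true) (R false))) ⟩
  Σ[ rows n ] (λ r → R true r + R false r) + Σ[ rows n ] exchange
    ≡⟨ sym (Σ-+ (rows n) (λ r → R true r + R false r) exchange) ⟩
  Σ[ rows n ] (λ r → (R true r + R false r) + exchange r)
    -- The induction leaves a boundary term at the second cell; the exchange at the first inner wall
    -- moves it to the first cell.
    ≡⟨ Σ-cong (rows n) (λ r → trans
         (cong (λ w → (R true r + R false r) + w * (g (false ∷ true ∷ r) - g (true ∷ false ∷ r))) (bulk a [] r))
         (telescope (W (true ∷ r)) (W (false ∷ r)) (g (true ∷ true ∷ r)) (g (true ∷ false ∷ r)) (g (false ∷ true ∷ r)) (g (false ∷ false ∷ r)))) ⟩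
  Σ[ rows n ] (λ r → G (true ∷ r) + G (false ∷ r))
    ≡⟨ sym (Σ-rows n G) ⟩
  Σ[ rows (suc n) ] G ∎
  where
  open ≡-Reasoning
  F G : Row → ℚ
  F τ = W τ * drift g τ
  G r = W r * (g (false ∷ r) - g (true ∷ r))
  H R : Bool → Row → ℚ
  H x σ = W (x ∷ σ) * drift (g ∘ (x ∷_)) σ
  R x r = W (x ∷ r) * (g (x ∷ false ∷ r) - g (x ∷ true ∷ r))
  exchange : Row → ℚ
  exchange r = W (true ∷ false ∷ r) * (g (false ∷ true ∷ r) - g (true ∷ false ∷ r))
  idle : ∀ w a d → w * ((a - a) + d) ≡ w * d
  idle = solve-∀ ℚ-ring
  moved : ∀ w a d → w * (a + d) ≡ w * d + w * a
  moved = solve-∀ ℚ-ring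
  regroup : ∀ a b c d e → (a + b) + ((c + e) + d) ≡ ((a + c) + (b + d)) + e
  regroup = solve-∀ ℚ-ring
  F-idle : ∀ x y r → mv (x ∷ y ∷ r) 0 ≡ x ∷ y ∷ r → F (x ∷ y ∷ r) ≡ H x (y ∷ r)
  F-idle x y r e = trans (cong (W (x ∷ y ∷ r) *_) (trans (drift-∷ g x (y ∷ r)) (cong (λ τ → (g τ - g (x ∷ y ∷ r)) + drift (g ∘ (x ∷_)) (y ∷ r)) e)))
    (idle (W (x ∷ y ∷ r)) (g (x ∷ y ∷ r)) (drift (g ∘ (x ∷_)) (y ∷ r)))
  -- Of the four beginnings only • ∘ reacts at the first inner wall. All other drift happens in the
  -- tail with the first cell frozen.
  firstMove : ∀ r →
    (F (true ∷ true ∷ r) + F (false ∷ true ∷ r)) + (F (true ∷ false ∷ r) + F (false ∷ false ∷ r)) ≡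
    ((H true (true ∷ r) + H true (false ∷ r)) + (H false (true ∷ r) + H false (false ∷ r))) + exchange r
  firstMove r = trans
    (cong₂ _+_ (cong₂ _+_ (F-idle true true r refl) (F-idle false true r refl))
      (cong₂ _+_ (trans (cong (W (true ∷ false ∷ r) *_) (drift-∷ g true (false ∷ r)))
          (moved (W (true ∷ false ∷ r)) (g (false ∷ true ∷ r) - g (true ∷ false ∷ r)) (drift (g ∘ (true ∷_)) (false ∷ r))))
        (F-idle false false r refl)))
    (regroup (H true (true ∷ r)) (H false (true ∷ r)) (H true (false ∷ r)) (H false (false ∷ r)) (exchange r))
  telescope : ∀ w v tt tf ft ff →
    (w * (tf - tt) + v * (ff - ft)) + (w + v) * (ft - tf) ≡ w * (ft - tt) + v * (ff - tf)
  telescope = solve-∀ ℚ-ring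

-- Each of the n + 1 walls contributes `g τ` plus an increment; the copies of `g τ` average to `g τ`
-- itself.
average-drift : (τ : Row) (g : Row → ℚ) →
  average (tasepMove (length τ)) (length τ) g τ ≡
  g τ + (ℤ.+ 1 / suc (length τ)) * ((g (tasepMove (length τ) τ 0) - g τ) + drift g τ)
average-drift τ g = begin
  c * Σ[ range 0 n ] (λ i → g (tasepMove n τ i))
    ≡⟨ cong (c *_) (Σ-upTo n (λ i → g (tasepMove n τ i))) ⟩
  c * (g (tasepMove n τ 0) + Σ[ upTo n ] (λ i → g (tasepMove n τ (suc i))))
    ≡⟨ cong (λ s → c * (g (tasepMove n τ 0) + s)) (Σ-cong-∈ (upTo n) (λ i i∈ →
         trans (cong g (tasepMove-suc τ i (∈P.∈-upTo⁻ i∈))) (add-sub (g (mv τ i)) (g τ)))) ⟩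
  c * (g (tasepMove n τ 0) + Σ[ upTo n ] (λ i → (g (mv τ i) - g τ) + g τ))
    ≡⟨ cong (λ s → c * (g (tasepMove n τ 0) + s)) (trans (Σ-+ (upTo n) (λ i → g (mv τ i) - g τ) (λ _ → g τ))
         (cong (drift g τ +_) (trans (Σ-const (upTo n) (g τ)) (cong (λ l → ℕtoℚ l * g τ) (ListP.length-upTo n))))) ⟩
  c * (g (tasepMove n τ 0) + (drift g τ + ℕtoℚ n * g τ))
    ≡⟨ collect c (g (tasepMove n τ 0)) (drift g τ) (ℕtoℚ n) (g τ) ⟩
  (c * (1ℚ + ℕtoℚ n)) * g τ + c * ((g (tasepMove n τ 0) - g τ) + drift g τ)
    ≡⟨ cong (λ u → u * g τ + c * ((g (tasepMove n τ 0) - g τ) + drift g τ))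
         (trans (cong (c *_) (sym (ℕtoℚ-suc n))) (1/suc*suc n)) ⟩
  1ℚ * g τ + c * ((g (tasepMove n τ 0) - g τ) + drift g τ)
    ≡⟨ cong (_+ c * ((g (tasepMove n τ 0) - g τ) + drift g τ)) (ℚP.*-identityˡ (g τ)) ⟩
  g τ + c * ((g (tasepMove n τ 0) - g τ) + drift g τ) ∎
  where
  open ≡-Reasoning
  n : ℕ
  n = length τ
  c : ℚ
  c = ℤ.+ 1 / suc n
  add-sub : ∀ a b → a ≡ (a - b) + b
  add-sub = solve-∀ ℚ-ring
  collect : ∀ c l d s g → c * (l + (d + s * g)) ≡ (c * (1ℚ + s)) * g + c * ((l - g) + d)
  collect = solve-∀ ℚ-ring

-- The left-wall relation E = 1 makes the inflow cancel the drift created by the other walls.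
stationary : ∀ n {W} → Ansatz W → (∀ r → W (false ∷ r) ≡ W r) → (g : Row → ℚ) →
  Σ[ rows (suc n) ] (λ τ → W τ * average (tasepMove (suc n)) (suc n) g τ) ≡ Σ[ rows (suc n) ] (λ τ → W τ * g τ)
stationary n {W} a left g = begin
  Σ[ rows (suc n) ] (λ τ → W τ * average (tasepMove (suc n)) (suc n) g τ)
    ≡⟨ Σ-cong-∈ (rows (suc n)) (λ τ τ∈ → trans (cong (W τ *_) (average-drift′ τ (∈-rows⁻ (suc n) τ∈)))
         (expand (W τ) (g τ) c (g (tasepMove (suc n) τ 0) - g τ) (drift g τ))) ⟩
  Σ[ rows (suc n) ] (λ τ → W τ * g τ + c * (W τ * (g (tasepMove (suc n) τ 0) - g τ) + W τ * drift g τ))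
    ≡⟨ Σ-+ (rows (suc n)) (λ τ → W τ * g τ) (λ τ → c * (W τ * (g (tasepMove (suc n) τ 0) - g τ) + W τ * drift g τ)) ⟩
  Σ[ rows (suc n) ] (λ τ → W τ * g τ) + Σ[ rows (suc n) ] (λ τ → c * (W τ * (g (tasepMove (suc n) τ 0) - g τ) + W τ * drift g τ))
    ≡⟨ cong (Σ[ rows (suc n) ] (λ τ → W τ * g τ) +_) (trans (Σ-*ˡ (rows (suc n)) c (λ τ → W τ * (g (tasepMove (suc n) τ 0) - g τ) + W τ * drift g τ))
         (trans (cong (c *_) balance) (ℚP.*-zeroʳ c))) ⟩
  Σ[ rows (suc n) ] (λ τ → W τ * g τ) + 0ℚ
    ≡⟨ ℚP.+-identityʳ (Σ[ rows (suc n) ] (λ τ → W τ * g τ)) ⟩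
  Σ[ rows (suc n) ] (λ τ → W τ * g τ) ∎
  where
  open ≡-Reasoning
  c : ℚ
  c = ℤ.+ 1 / suc (suc n)
  expand : ∀ w g c l d → w * (g + c * (l + d)) ≡ w * g + c * (w * l + w * d)
  expand = solve-∀ ℚ-ring
  inflow : Row → ℚ
  inflow τ = W τ * (g (tasepMove (suc n) τ 0) - g τ)
  cancel : ∀ w a b → (v : ℚ) → (v * (a - a) + w * (a - b)) + w * (b - a) ≡ 0ℚ
  cancel = solve-∀ ℚ-ring
  balance : Σ[ rows (suc n) ] (λ τ → inflow τ + W τ * drift g τ) ≡ 0ℚ
  balance = begin
    Σ[ rows (suc n) ] (λ τ → inflow τ + W τ * drift g τ)
      ≡⟨ Σ-+ (rows (suc n)) inflow (λ τ → W τ * drift g τ) ⟩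
    Σ[ rows (suc n) ] inflow + Σ[ rows (suc n) ] (λ τ → W τ * drift g τ)
      ≡⟨ cong₂ _+_ (Σ-rows n inflow) (Σ-drift n a g) ⟩
    Σ[ rows n ] (λ r → inflow (true ∷ r) + inflow (false ∷ r)) + Σ[ rows n ] (λ r → W r * (g (false ∷ r) - g (true ∷ r)))
      ≡⟨ sym (Σ-+ (rows n) (λ r → inflow (true ∷ r) + inflow (false ∷ r)) (λ r → W r * (g (false ∷ r) - g (true ∷ r)))) ⟩
    Σ[ rows n ] (λ r → (inflow (true ∷ r) + inflow (false ∷ r)) + W r * (g (false ∷ r) - g (true ∷ r)))
      ≡⟨ Σ-cong (rows n) (λ r → trans
           (cong (λ w → (inflow (true ∷ r) + w * (g (true ∷ r) - g (false ∷ r))) + W r * (g (false ∷ r) - g (true ∷ r))) (left r))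
           (cancel (W r) (g (true ∷ r)) (g (false ∷ r)) (W (true ∷ r)))) ⟩
    Σ[ rows n ] (λ _ → 0ℚ)
      ≡⟨ Σ-0 (rows n) ⟩
    0ℚ ∎
  average-drift′ : ∀ τ → length τ ≡ suc n →
    average (tasepMove (suc n)) (suc n) g τ ≡ g τ + c * ((g (tasepMove (suc n) τ 0) - g τ) + drift g τ)
  average-drift′ τ e = subst (λ m → average (tasepMove m) m g τ ≡
    g τ + (ℤ.+ 1 / suc m) * ((g (tasepMove m τ 0) - g τ) + drift g τ)) e (average-drift τ g)

-- Convergence

infixr 8 _^^_
_^^_ : ℚ → ℕ → ℚ
q ^^ zero = 1ℚ
q ^^ suc s = q * q ^^ s

0≤^^ : ∀ {q} s → 0ℚ ≤ q → 0ℚ ≤ q ^^ s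
0≤^^ zero _ = 0≤ind true
0≤^^ (suc s) 0≤q = 0≤* 0≤q (0≤^^ s 0≤q)

0<^^ : ∀ {q} s → 0ℚ < q → 0ℚ < q ^^ s
0<^^ zero _ = ℚP.positive⁻¹ 1ℚ
0<^^ {q} (suc s) 0<q = subst (_< q * q ^^ s) (ℚP.*-zeroʳ q) (ℚP.*-monoʳ-<-pos q {{positive 0<q}} (0<^^ s 0<q))

^^≤1 : ∀ {q} s → 0ℚ ≤ q → q ≤ 1ℚ → q ^^ s ≤ 1ℚ
^^≤1 zero _ _ = ℚP.≤-refl
^^≤1 {q} (suc s) 0≤q q≤1 = ℚP.≤-trans (*-mono-nonNeg q 0≤q (^^≤1 s 0≤q q≤1)) (ℚP.≤-trans (ℚP.≤-reflexive (ℚP.*-identityʳ q)) q≤1)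

p≤q⇒0≤q-p : ∀ {p q} → p ≤ q → 0ℚ ≤ q - p
p≤q⇒0≤q-p {p} {q} p≤q = subst (_≤ q - p) (ℚP.+-inverseʳ p) (ℚP.+-monoˡ-≤ (- p) p≤q)

0≤q-p⇒p≤q : ∀ {p q} → 0ℚ ≤ q - p → p ≤ q
0≤q-p⇒p≤q {p} {q} 0≤ = subst₂ _≤_ (ℚP.+-identityˡ p) (cancel p q) (ℚP.+-monoˡ-≤ p 0≤)
  where
  cancel : ∀ p q → (q - p) + p ≡ q
  cancel = solve-∀ ℚ-ring

-- The bound 1 / (1 + sε) for the power, written without division. From s to s + 1 the product
-- decreases by (1 + s) ε² (1 - ε)^s, which is the identity `gap`.
bernoulli : ∀ ε s → 0ℚ ≤ ε → ε ≤ 1ℚ → ((1ℚ - ε) ^^ s) * (1ℚ + ℕtoℚ s * ε) ≤ 1ℚ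
bernoulli ε zero _ _ = ℚP.≤-reflexive (base ε)
  where
  base : ∀ ε → 1ℚ * (1ℚ + 0ℚ * ε) ≡ 1ℚ
  base = solve-∀ ℚ-ring
bernoulli ε (suc s) 0≤ε ε≤1 = ℚP.≤-trans (0≤q-p⇒p≤q (subst (0ℚ ≤_) (trans (gap ((1ℚ - ε) ^^ s) ε (ℕtoℚ s))
    (cong (λ k → (1ℚ - ε) ^^ s * (1ℚ + ℕtoℚ s * ε) - ((1ℚ - ε) * (1ℚ - ε) ^^ s) * (1ℚ + k * ε)) (sym (ℕtoℚ-suc s)))) 0≤gap))
  (bernoulli ε s 0≤ε ε≤1)
  where
  gap : ∀ q ε s → q * (ε * (ε + s * ε)) ≡ q * (1ℚ + s * ε) - ((1ℚ - ε) * q) * (1ℚ + (1ℚ + s) * ε)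
  gap = solve-∀ ℚ-ring
  0≤gap : 0ℚ ≤ (1ℚ - ε) ^^ s * (ε * (ε + ℕtoℚ s * ε))
  0≤gap = 0≤* (0≤^^ s (p≤q⇒0≤q-p ε≤1)) (0≤* 0≤ε (ℚP.+-mono-≤ {0ℚ} {ε} {0ℚ} {ℕtoℚ s * ε} 0≤ε (0≤* (0≤ℕtoℚ s) 0≤ε)))

-- The denominator is a witness: multiplied by it, `r` becomes its numerator, a positive integer.
archimedean : ∀ r → 0ℚ < r → ∃ λ s → 1ℚ ≤ ℕtoℚ s * r
archimedean r@(mkℚ (ℤ.+ zero) d _) 0<r with ℚP.drop-*<* 0<r
... | ℤ.+<+ ()
archimedean r@(mkℚ ℤ.-[1+ a ] d _) 0<r with ℚP.drop-*<* 0<r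
... | ()
archimedean r@(mkℚ (ℤ.+ suc a) d _) 0<r = suc d , subst (1ℚ ≤_) (sym scaled)
    (subst (1ℚ ≤_) (sym (ℕtoℚ-suc a)) (ℚP.+-monoʳ-≤ 1ℚ {0ℚ} (0≤ℕtoℚ a)))
  where
  scaled : ℕtoℚ (suc d) * r ≡ ℕtoℚ (suc a)
  scaled = ℚP.toℚᵘ-injective (ℚᵘP.≃-trans (ℚP.toℚᵘ-homo-* (ℕtoℚ (suc d)) r)
    (ℚᵘP.≃-trans (ℚᵘP.*-congʳ {mkℚᵘ (ℤ.+ suc a) d} (toℚᵘ-/ (suc d) 0))
      (ℚᵘP.≃-trans (*≡* (trans (ℤP.*-identityʳ _) (trans (ℤP.*-comm (ℤ.+ suc d) (ℤ.+ suc a))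
        (cong (λ k → ℤ.+ suc a ℤ.* (ℤ.+ k)) (sym (ℕP.*-identityˡ (suc d)))))))
        (ℚᵘP.≃-sym (toℚᵘ-/ (suc a) 0)))))

-- With s ε η at least 1, Bernoulli's bound gives (1 - ε)^s (1 + s ε) ≤ 1 ≤ s ε η < η (1 + s ε), and
-- the positive factor 1 + s ε cancels.
^^→0 : ∀ {ε} → 0ℚ < ε → ε ≤ 1ℚ → ∀ η → 0ℚ < η → ∃ λ s → (1ℚ - ε) ^^ s < η
^^→0 {ε} 0<ε ε≤1 η 0<η with archimedean (ε * η) (subst (_< ε * η) (ℚP.*-zeroʳ ε) (ℚP.*-monoʳ-<-pos ε {{positive 0<ε}} 0<η))
... | s , 1≤ = s , ℚP.*-cancelʳ-<-nonNeg (1ℚ + ℕtoℚ s * ε) {{nonNegative 0≤D}}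
    (ℚP.≤-<-trans (bernoulli ε s (ℚP.<⇒≤ 0<ε) ε≤1) (ℚP.≤-<-trans 1≤
      (subst₂ _<_ (regroupˡ (ℕtoℚ s) ε η) (regroupʳ (ℕtoℚ s) ε η) (ℚP.+-monoˡ-< (ℕtoℚ s * ε * η) 0<η))))
  where
  0≤D : 0ℚ ≤ 1ℚ + ℕtoℚ s * ε
  0≤D = ℚP.+-mono-≤ {0ℚ} {1ℚ} {0ℚ} {ℕtoℚ s * ε} (0≤ind true) (0≤* (0≤ℕtoℚ s) (ℚP.<⇒≤ 0<ε))
  regroupˡ : ∀ s ε η → 0ℚ + s * ε * η ≡ s * (ε * η)
  regroupˡ = solve-∀ ℚ-ring
  regroupʳ : ∀ s ε η → η + s * ε * η ≡ η * (1ℚ + s * ε)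
  regroupʳ = solve-∀ ℚ-ring

∣∣<-intro : ∀ {p ε} → p < ε → - p < ε → ∣ p ∣ < ε
∣∣<-intro {p} p<ε -p<ε with ℚP.∣p∣≡p∨∣p∣≡-p p
... | inj₁ e = subst (_< _) (sym e) p<ε
... | inj₂ e = subst (_< _) (sym e) -p<ε

∣-∣≤ : ∀ {a b lo hi} → lo ≤ a → a ≤ hi → lo ≤ b → b ≤ hi → ∀ {ε} → hi - lo < ε → ∣ a - b ∣ < ε
∣-∣≤ {a} {b} {lo} {hi} lo≤a a≤hi lo≤b b≤hi hi-lo<ε = ∣∣<-intro
  (ℚP.≤-<-trans (ℚP.+-mono-≤ a≤hi (ℚP.neg-antimono-≤ lo≤b)) hi-lo<ε)
  (ℚP.≤-<-trans (subst (_≤ hi - lo) (flip a b) (ℚP.+-mono-≤ b≤hi (ℚP.neg-antimono-≤ lo≤a))) hi-lo<ε)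
  where
  flip : ∀ a b → b - a ≡ - (a - b)
  flip = solve-∀ ℚ-ring

-- Descent to the full row

full : ℕ → Row
full n = replicate n true

-- The sum of the positions of the white particles, a bound on the distance to the full row.
Φ : Row → ℕ
Φ [] = 0
Φ (x ∷ r) = (if x then 0 else 1) ℕ.+ (whites r ℕ.+ Φ r)

maxΦ : ℕ → ℕ
maxΦ zero = 0
maxΦ (suc n) = 1 ℕ.+ (n ℕ.+ maxΦ n)

whites≤length : ∀ r → whites r ℕ.≤ length r
whites≤length [] = z≤n
whites≤length (true ∷ r) = ℕP.m≤n⇒m≤1+n (whites≤length r)
whites≤length (false ∷ r) = s≤s (whites≤length r)

Φ≤maxΦ : ∀ r → Φ r ℕ.≤ maxΦ (length r)
Φ≤maxΦ [] = z≤n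
Φ≤maxΦ (true ∷ r) = ℕP.m≤n⇒m≤1+n (ℕP.+-mono-≤ (whites≤length r) (Φ≤maxΦ r))
Φ≤maxΦ (false ∷ r) = s≤s (ℕP.+-mono-≤ (whites≤length r) (Φ≤maxΦ r))

-- Behind a black head the first white particle of `r` has a black left neighbour, and exchanging
-- the two lowers its position by one. The invariance of `whites` is carried along because `Φ` of a
-- longer row counts the white particles of its tail.
mv-descend : ∀ r → (r ≡ full (length r)) ⊎
  (∃ λ i → i ℕ.≤ length r × suc (Φ (mv (true ∷ r) i)) ≡ Φ (true ∷ r) × whites (mv (true ∷ r) i) ≡ whites r)
mv-descend [] = inj₁ refl
mv-descend (false ∷ r) = inj₂ (0 , z≤n , cong suc (sym (ℕP.+-suc (whites r) (whites r ℕ.+ Φ r))) , refl)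
mv-descend (true ∷ r) with mv-descend r
... | inj₁ e = inj₁ (cong (true ∷_) e)
... | inj₂ (i , i≤ , eΦ , ew) = inj₂ (suc i , s≤s i≤ ,
  trans (sym (ℕP.+-suc (whites (mv (true ∷ r) i)) (Φ (mv (true ∷ r) i)))) (cong₂ ℕ._+_ ew eΦ) , ew)

-- A white particle in cell 1 contributes 1 to `Φ` and disappears at wall 0. If cell 1 is black,
-- `mv-descend` applies.
descend : ∀ τ → (τ ≡ full (length τ)) ⊎
  (∃ λ i → i ℕ.≤ length τ × suc (Φ (tasepMove (length τ) τ i)) ≡ Φ τ)
descend [] = inj₁ refl
descend (false ∷ r) = inj₂ (0 , z≤n , refl)
descend (true ∷ r) with mv-descend r
... | inj₁ e = inj₁ (cong (true ∷_) e)
... | inj₂ (i , i≤ , e , _) = inj₂ (suc i , s≤s i≤ , trans (cong (suc ∘ Φ) (tasepMove-suc (true ∷ r) i (s≤s i≤))) e)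

Σ-nonNeg : (xs : List A) {f : A → ℚ} → (∀ x → x ∈ xs → 0ℚ ≤ f x) → 0ℚ ≤ Σ[ xs ] f
Σ-nonNeg xs {f} f≥0 = subst (_≤ Σ[ xs ] f) (Σ-0 xs) (Σ-mono-≤ xs f≥0)

term≤Σ : (xs : List A) {f : A → ℚ} → (∀ x → x ∈ xs → 0ℚ ≤ f x) → ∀ {x} → x ∈ xs → f x ≤ Σ[ xs ] f
term≤Σ (x ∷ xs) {f} f≥0 (here refl) = subst (_≤ f x + Σ[ xs ] f) (ℚP.+-identityʳ (f x))
  (ℚP.+-monoʳ-≤ (f x) {0ℚ} {Σ[ xs ] f} (Σ-nonNeg xs (λ y y∈ → f≥0 y (there y∈))))
term≤Σ (x ∷ xs) {f} f≥0 {y} (there y∈) = subst (_≤ f x + Σ[ xs ] f) (ℚP.+-identityˡ (f y))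
  (ℚP.+-mono-≤ {0ℚ} {f x} {f y} {Σ[ xs ] f} (f≥0 x (here refl)) (term≤Σ xs (λ z z∈ → f≥0 z (there z∈)) y∈))

-- `iter` adds its last step on the outside, while duality hands a step of the law to the inside of
-- the test function.
iter-comm : {S : Set} (t : ℕ) (F : (S → ℚ) → (S → ℚ)) (P : S → ℚ) → iter t F (F P) ≡ F (iter t F P)
iter-comm zero F P = refl
iter-comm (suc t) F P = cong F (iter-comm t F P)

iter-+ : {S : Set} (s t : ℕ) (F : (S → ℚ) → (S → ℚ)) (P : S → ℚ) → iter (s ℕ.+ t) F P ≡ iter s F (iter t F P)
iter-+ zero t F P = refl
iter-+ (suc s) t F P = cong F (iter-+ s t F P)

∈-range⁺ : ∀ {n i} → i ℕ.≤ n → i ∈ range 0 n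
∈-range⁺ i≤n = ∈P.∈-applyUpTo⁺ (λ k → k) (s≤s i≤n)

module _ {S : Set} (f : S → ℕ → S) (n : ℕ) where

  private
    K : (S → ℚ) → S → ℚ
    K = average f n

  -- Linearity and preservation of constants in one formula. With a = 1 and a = -1 it turns
  -- positivity of the operator into lower and upper bounds.
  average-affine : ∀ a b (g : S → ℚ) x → K (λ y → a * g y + b) x ≡ a * K g x + b
  -- Of the list of walls only the length matters: it cancels the factor 1 / (n + 1).
  average-affine a b g x = go (range 0 n) (ListP.length-applyUpTo (λ k → k) (suc n))
    where
    regroup : ∀ c a b l s → c * (a * s + l * b) ≡ a * (c * s) + (c * l) * b
    regroup = solve-∀ ℚ-ring
    c : ℚ
    c = ℤ.+ 1 / suc n
    go : ∀ I → length I ≡ suc n → c * Σ[ I ] (λ i → a * g (f x i) + b) ≡ a * (c * Σ[ I ] (λ i → g (f x i))) + b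
    go I e = trans (cong (c *_) (trans (Σ-+ I (λ i → a * g (f x i)) (λ _ → b)) (cong₂ _+_ (Σ-*ˡ I a (λ i → g (f x i))) (Σ-const I b))))
      (trans (regroup c a b (ℕtoℚ (length I)) (Σ[ I ] (λ i → g (f x i))))
        (cong (a * (c * Σ[ I ] (λ i → g (f x i))) +_)
          (trans (cong (_* b) (trans (cong (λ l → c * ℕtoℚ l) e) (1/suc*suc n))) (ℚP.*-identityˡ b))))

  average-cong : ∀ {g h : S → ℚ} → (∀ x → g x ≡ h x) → ∀ x → K g x ≡ K h x
  average-cong e x = cong ((ℤ.+ 1 / suc n) *_) (Σ-cong (range 0 n) (λ i → e (f x i)))

  average-hit : ∀ {g : S → ℚ} x i → (∀ j → j ℕ.≤ n → 0ℚ ≤ g (f x j)) → i ℕ.≤ n → (ℤ.+ 1 / suc n) * g (f x i) ≤ K g x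
  average-hit {g} x i g≥0 i≤n = *-mono-nonNeg (ℤ.+ 1 / suc n) (ℚP.<⇒≤ (0<1/suc n))
    (term≤Σ (range 0 n) {λ j → g (f x j)} (λ j j∈ → g≥0 j (∈-range⁻ j∈)) (∈-range⁺ i≤n))

  average-nonNeg : ∀ {g : S → ℚ} x → (∀ j → j ℕ.≤ n → 0ℚ ≤ g (f x j)) → 0ℚ ≤ K g x
  average-nonNeg {g} x g≥0 = 0≤* (ℚP.<⇒≤ (0<1/suc n)) (Σ-nonNeg (range 0 n) {λ j → g (f x j)} (λ j j∈ → g≥0 j (∈-range⁻ j∈)))

descend-at : ∀ n τ → length τ ≡ n → (τ ≡ full n) ⊎
  (∃ λ i → i ℕ.≤ n × suc (Φ (tasepMove n τ i)) ≡ Φ τ)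
descend-at n τ refl = descend τ

mean-≥ : (xs : List A) {μ g : A → ℚ} {lo : ℚ} → IsDistribution xs μ → (∀ x → x ∈ xs → lo ≤ g x) →
  lo ≤ Σ[ xs ] (λ x → μ x * g x)
mean-≥ xs {μ} {g} {lo} (μ≥0 , Σμ≡1) lo≤g =
  subst (_≤ Σ[ xs ] (λ x → μ x * g x)) (trans (Σ-*ʳ xs lo μ) (trans (cong (_* lo) Σμ≡1) (ℚP.*-identityˡ lo)))
    (Σ-mono-≤ xs (λ x x∈ → *-mono-nonNeg (μ x) (μ≥0 x x∈) (lo≤g x x∈)))

mean-≤ : (xs : List A) {μ g : A → ℚ} {hi : ℚ} → IsDistribution xs μ → (∀ x → x ∈ xs → g x ≤ hi) →
  Σ[ xs ] (λ x → μ x * g x) ≤ hi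
mean-≤ xs {μ} {g} {hi} (μ≥0 , Σμ≡1) g≤hi =
  subst (Σ[ xs ] (λ x → μ x * g x) ≤_) (trans (Σ-*ʳ xs hi μ) (trans (cong (_* hi) Σμ≡1) (ℚP.*-identityˡ hi)))
    (Σ-mono-≤ xs (λ x x∈ → *-mono-nonNeg (μ x) (μ≥0 x x∈) (g≤hi x x∈)))

-- An abstract Markov operator on functions: positive and compatible with affine maps. Bounds lo ≤ g
-- ≤ hi are handled as nonnegativity of g - lo and hi - g. `K-cong` takes the place of function
-- extensionality.
module Contraction {S : Set} (space : List S) (K : (S → ℚ) → S → ℚ)
  (K-affine : ∀ a b g x → K (λ y → a * g y + b) x ≡ a * K g x + b)
  (K-cong : ∀ {g h} → (∀ x → g x ≡ h x) → ∀ x → K g x ≡ K h x)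
  (K-nonNeg : ∀ {g} → (∀ x → x ∈ space → 0ℚ ≤ g x) → ∀ x → x ∈ space → 0ℚ ≤ K g x) where

  NonNeg : (S → ℚ) → Set
  NonNeg g = ∀ x → x ∈ space → 0ℚ ≤ g x

  Within : ℚ → ℚ → (S → ℚ) → Set
  Within lo hi g = ∀ x → x ∈ space → lo ≤ g x × g x ≤ hi

  iter-affine : ∀ t a b (g : S → ℚ) x → iter t K (λ y → a * g y + b) x ≡ a * iter t K g x + b
  iter-affine zero a b g x = refl
  iter-affine (suc t) a b g x = trans (K-cong (iter-affine t a b g) x) (K-affine a b (iter t K g) x)

  iter-nonNeg : ∀ t {g} → NonNeg g → NonNeg (iter t K g)
  iter-nonNeg zero g≥0 = g≥0
  iter-nonNeg (suc t) g≥0 = K-nonNeg (iter-nonNeg t g≥0)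

  iter-within : ∀ t {lo hi g} → Within lo hi g → Within lo hi (iter t K g)
  iter-within t {lo} {hi} {g} w x x∈ =
    0≤q-p⇒p≤q (subst (0ℚ ≤_) (trans (iter-affine t 1ℚ (- lo) g x) (below (iter t K g x) lo))
      (iter-nonNeg t {λ y → 1ℚ * g y + - lo}
        (λ y y∈ → subst (0ℚ ≤_) (sym (below (g y) lo)) (p≤q⇒0≤q-p (proj₁ (w y y∈)))) x x∈)) ,
    0≤q-p⇒p≤q (subst (0ℚ ≤_) (trans (iter-affine t (- 1ℚ) hi g x) (above (iter t K g x) hi))
      (iter-nonNeg t {λ y → - 1ℚ * g y + hi}
        (λ y y∈ → subst (0ℚ ≤_) (sym (above (g y) hi)) (p≤q⇒0≤q-p (proj₂ (w y y∈)))) x x∈))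
    where
    below : ∀ a b → 1ℚ * a + - b ≡ a - b
    below = solve-∀ ℚ-ring
    above : ∀ a b → - 1ℚ * a + b ≡ b - a
    above = solve-∀ ℚ-ring

  -- `hit` is Doeblin's condition in dual form: after M steps, every starting state has put mass at
  -- least ε on `x₀`.
  module Hitting (x₀ : S) (M : ℕ) (ε : ℚ) (0<ε : 0ℚ < ε) (ε≤1 : ε ≤ 1ℚ)
    (hit : ∀ {g} → NonNeg g → ∀ x → x ∈ space → ε * g x₀ ≤ iter M K g x) where

    -- The common mass contributes the same `ε * g x₀` at every state, so only the fraction 1 - ε of
    -- the value can vary. The two bounds come from `hit` for g - lo and for hi - g.
    contract : ∀ {lo hi g} → Within lo hi g →
      Within (ε * g x₀ + (1ℚ - ε) * lo) (ε * g x₀ + (1ℚ - ε) * hi) (iter M K g)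
    contract {lo} {hi} {g} w x x∈ =
      0≤q-p⇒p≤q (subst (0ℚ ≤_)
        (trans (cong (_- ε * (1ℚ * g x₀ + - lo)) (iter-affine M 1ℚ (- lo) g x))
          (below ε (iter M K g x) (g x₀) lo))
        (p≤q⇒0≤q-p (hit {λ y → 1ℚ * g y + - lo}
          (λ y y∈ → subst (0ℚ ≤_) (below₀ (g y) lo) (p≤q⇒0≤q-p (proj₁ (w y y∈)))) x x∈))) ,
      0≤q-p⇒p≤q (subst (0ℚ ≤_)
        (trans (cong (_- ε * (- 1ℚ * g x₀ + hi)) (iter-affine M (- 1ℚ) hi g x))
          (above ε (iter M K g x) (g x₀) hi))
        (p≤q⇒0≤q-p (hit {λ y → - 1ℚ * g y + hi}
          (λ y y∈ → subst (0ℚ ≤_) (above₀ (g y) hi) (p≤q⇒0≤q-p (proj₂ (w y y∈)))) x x∈)))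
      where
      below : ∀ ε k c l → (1ℚ * k + - l) - ε * (1ℚ * c + - l) ≡ k - (ε * c + (1ℚ - ε) * l)
      below = solve-∀ ℚ-ring
      above : ∀ ε k c h → (- 1ℚ * k + h) - ε * (- 1ℚ * c + h) ≡ (ε * c + (1ℚ - ε) * h) - k
      above = solve-∀ ℚ-ring
      below₀ : ∀ a b → a - b ≡ 1ℚ * a + - b
      below₀ = solve-∀ ℚ-ring
      above₀ : ∀ a b → b - a ≡ - 1ℚ * a + b
      above₀ = solve-∀ ℚ-ring

    oscillation : ∀ s {g} → Within 0ℚ 1ℚ g →
      ∃ λ lo → ∃ λ hi → hi - lo ≡ (1ℚ - ε) ^^ s × Within lo hi (iter (s ℕ.* M) K g)
    oscillation zero w = 0ℚ , 1ℚ , refl , w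
    oscillation (suc s) {g} w with oscillation s w
    ... | lo , hi , e , w′ = ε * c + (1ℚ - ε) * lo , ε * c + (1ℚ - ε) * hi ,
      trans (width ε c lo hi) (cong ((1ℚ - ε) *_) e) ,
      subst (Within (ε * c + (1ℚ - ε) * lo) (ε * c + (1ℚ - ε) * hi)) (sym (iter-+ M (s ℕ.* M) K g)) (contract w′)
      where
      c : ℚ
      c = iter (s ℕ.* M) K g x₀
      width : ∀ ε c l h → (ε * c + (1ℚ - ε) * h) - (ε * c + (1ℚ - ε) * l) ≡ (1ℚ - ε) * (h - l)
      width = solve-∀ ℚ-ring

    -- By duality the value at time t is the μ-mean of `iter t K g`; by invariance the limit is the
    -- π-mean of the same function. Two means of a function with values in [lo, hi] differ by at
    -- most hi - lo.
    converges : ∀ {μ π} {law : ℕ → S → ℚ} → IsDistribution space μ → IsDistribution space π →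
      (∀ t g → Σ[ space ] (λ τ → law t τ * g τ) ≡ Σ[ space ] (λ τ → μ τ * iter t K g τ)) →
      (∀ g → Σ[ space ] (λ τ → π τ * K g τ) ≡ Σ[ space ] (λ τ → π τ * g τ)) →
      ∀ {g} → Within 0ℚ 1ℚ g →
      (λ t → Σ[ space ] (λ τ → law t τ * g τ)) ⟶ (Σ[ space ] (λ τ → π τ * g τ))
    converges {μ} {π} {law} μ-dist π-dist law-dual invariant {g} w η 0<η =
      let s , <η = ^^→0 0<ε ε≤1 η 0<η
          lo , hi , e , w′ = oscillation s w
      in s ℕ.* M , close (s ℕ.* M) (subst (_< η) (sym e) <η) w′
      where
      iter-invariant : ∀ t → Σ[ space ] (λ τ → π τ * iter t K g τ) ≡ Σ[ space ] (λ τ → π τ * g τ)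
      iter-invariant zero = refl
      iter-invariant (suc t) = trans (invariant (iter t K g)) (iter-invariant t)
      close : ∀ T {lo hi} → hi - lo < η → Within lo hi (iter T K g) → ∀ t → T ℕ.≤ t →
        ∣ Σ[ space ] (λ τ → law t τ * g τ) - Σ[ space ] (λ τ → π τ * g τ) ∣ < η
      close T {lo} {hi} hi-lo<η wT t T≤t =
        subst₂ (λ a b → ∣ a - b ∣ < η) (sym (law-dual t g)) (iter-invariant t)
          (∣-∣≤ {Σ[ space ] (λ τ → μ τ * iter t K g τ)} {Σ[ space ] (λ τ → π τ * iter t K g τ)} {lo} {hi}
            (mean-≥ space μ-dist (λ x x∈ → proj₁ (late x x∈))) (mean-≤ space μ-dist (λ x x∈ → proj₂ (late x x∈)))
            (mean-≥ space π-dist (λ x x∈ → proj₁ (late x x∈))) (mean-≤ space π-dist (λ x x∈ → proj₂ (late x x∈)))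
            {η} hi-lo<η)
        where
        -- Further averaging keeps the values in the interval reached at time T, so one T serves all
        -- later times.
        late : Within lo hi (iter t K g)
        late = subst (Within lo hi)
          (trans (sym (iter-+ (t ℕ.∸ T) T K g)) (cong (λ u → iter u K g) (ℕP.m∸n+n≡m T≤t)))
          (iter-within (t ℕ.∸ T) wT)

module Path (n : ℕ) (δ : ℚ) (0≤δ : 0ℚ ≤ δ) (K : (Row → ℚ) → Row → ℚ)
  (K-hit : ∀ {g} → (∀ x → x ∈ rows (suc n) → 0ℚ ≤ g x) → ∀ x i → x ∈ rows (suc n) → i ℕ.≤ suc n →
    δ * g (tasepMove (suc n) x i) ≤ K g x)
  (iter-nonNeg : ∀ t {g} → (∀ x → x ∈ rows (suc n) → 0ℚ ≤ g x) → ∀ x → x ∈ rows (suc n) → 0ℚ ≤ iter t K g x) where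

  private
    N : ℕ
    N = suc n

  -- From any row the full row is reached along a path of prescribed length: once there, wall 0 has no effect.
  path : ∀ m {g} → (∀ x → x ∈ rows N → 0ℚ ≤ g x) → ∀ x → x ∈ rows N → Φ x ℕ.≤ m → δ ^^ m * g (full N) ≤ iter m K g x
  path m {g} g≥0 x x∈ Φ≤ with descend-at N x (∈-rows⁻ N x∈)
  path zero {g} g≥0 x x∈ Φ≤ | inj₁ refl = ℚP.≤-reflexive (ℚP.*-identityˡ (g (full N)))
  path zero g≥0 x x∈ Φ≤ | inj₂ (i , i≤ , e) with subst (ℕ._≤ 0) (sym e) Φ≤
  ... | ()
  path (suc m) {g} g≥0 x x∈ Φ≤ | inj₁ refl = ℚP.≤-trans
    (subst (_≤ δ * iter m K g (full N)) (sym (ℚP.*-assoc δ (δ ^^ m) (g (full N))))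
      (*-mono-nonNeg δ 0≤δ (path m g≥0 (full N) x∈ (subst (ℕ._≤ m) (sym (Φ-full N)) z≤n))))
    (K-hit (iter-nonNeg m g≥0) (full N) 0 x∈ z≤n)
    where
    whites-full : ∀ n → whites (full n) ≡ 0
    whites-full zero = refl
    whites-full (suc n) = whites-full n
    Φ-full : ∀ n → Φ (full n) ≡ 0
    Φ-full zero = refl
    Φ-full (suc n) = cong₂ ℕ._+_ (whites-full n) (Φ-full n)
  path (suc m) {g} g≥0 x x∈ Φ≤ | inj₂ (i , i≤ , e) = ℚP.≤-trans
    (subst (_≤ δ * iter m K g (tasepMove N x i)) (sym (ℚP.*-assoc δ (δ ^^ m) (g (full N))))
      (*-mono-nonNeg δ 0≤δ (path m g≥0 (tasepMove N x i) (rows-closed N x i x∈ i≤)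
        (ℕP.≤-pred (subst (ℕ._≤ suc m) (sym e) Φ≤)))))
    (K-hit (iter-nonNeg m g≥0) x i x∈ i≤)


tasep-law : ∀ n μ t (g : Row → ℚ) →
  Σ[ rows n ] (λ τ → lawS n 1ℚ 1ℚ 1ℚ μ t τ * g τ) ≡
  Σ[ rows n ] (λ τ → μ τ * iter t (average (tasepMove n) n) g τ)
tasep-law n μ zero g = refl
tasep-law n μ (suc t) g = trans
  (stepLaw-dual rowEq (rows n) (tasepMove n) n (rows-Δ n) (rows-closed n) (lawS n 1ℚ 1ℚ 1ℚ μ t) g)
  (trans (tasep-law n μ t (average (tasepMove n) n g))
    (cong (λ h → Σ[ rows n ] (λ τ → μ τ * h τ)) (iter-comm t (average (tasepMove n) n) g)))

1/suc≤1 : ∀ n → (ℤ.+ 1 / suc n) ≤ 1ℚ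
1/suc≤1 n = subst₂ _≤_ (ℚP.*-identityʳ (ℤ.+ 1 / suc n)) (1/suc*suc n) (*-mono-nonNeg (ℤ.+ 1 / suc n) (ℚP.<⇒≤ (0<1/suc n))
  (subst (1ℚ ≤_) (sym (ℕtoℚ-suc n)) (ℚP.+-monoʳ-≤ 1ℚ {0ℚ} (0≤ℕtoℚ n))))

tasep-converges : ∀ n {μ π} → IsDistribution (rows (suc n)) μ → IsDistribution (rows (suc n)) π →
  (∀ g → Σ[ rows (suc n) ] (λ τ → π τ * average (tasepMove (suc n)) (suc n) g τ) ≡ Σ[ rows (suc n) ] (λ τ → π τ * g τ)) →
  ∀ {g} → (∀ τ → τ ∈ rows (suc n) → 0ℚ ≤ g τ × g τ ≤ 1ℚ) →
  (λ t → Σ[ rows (suc n) ] (λ τ → lawS (suc n) 1ℚ 1ℚ 1ℚ μ t τ * g τ)) ⟶ (Σ[ rows (suc n) ] (λ τ → π τ * g τ))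
tasep-converges n {μ} {π} μ-dist π-dist invariant {g} w =
  C.Hitting.converges (full N) (maxΦ N) (δ ^^ maxΦ N) (0<^^ (maxΦ N) (0<1/suc N))
    (^^≤1 (maxΦ N) (ℚP.<⇒≤ (0<1/suc N)) (1/suc≤1 N))
    (λ g≥0 x x∈ → P.path (maxΦ N) g≥0 x x∈ (subst (λ m → Φ x ℕ.≤ maxΦ m) (∈-rows⁻ N x∈) (Φ≤maxΦ x)))
    {μ} {π} {lawS N 1ℚ 1ℚ 1ℚ μ} μ-dist π-dist (tasep-law N μ) invariant {g} w
  where
  N : ℕ
  N = suc n
  δ : ℚ
  δ = ℤ.+ 1 / suc N
  module C = Contraction (rows N) (average (tasepMove N) N) (average-affine (tasepMove N) N)
    (λ {g} {h} → average-cong (tasepMove N) N {g} {h})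
    (λ {g} g≥0 x x∈ → average-nonNeg (tasepMove N) N {g} x (λ j j≤ → g≥0 (tasepMove N x j) (rows-closed N x j x∈ j≤)))
  module P = Path n δ (ℚP.<⇒≤ (0<1/suc N)) (average (tasepMove N) N)
    (λ {g} g≥0 x i x∈ i≤ → average-hit (tasepMove N) N {g} x i (λ j j≤ → g≥0 (tasepMove N x j) (rows-closed N x j x∈ j≤)) i≤)
    C.iter-nonNeg

-- Complete configurations as walks

-- The height of a prefix is (black − white) / 2; ok h t b says that the walk started at
-- height h with columns (t , b) stays nonnegative and ends at height 0.
ok : ℕ → Row → Row → Bool
ok h [] [] = h ≡ᵇ 0
ok h [] (_ ∷ _) = false
ok h (_ ∷ _) [] = false
ok h (true ∷ t) (true ∷ b) = ok (suc h) t b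
ok h (true ∷ t) (false ∷ b) = ok h t b
ok h (false ∷ t) (true ∷ b) = ok h t b
ok zero (false ∷ t) (false ∷ b) = false
ok (suc h) (false ∷ t) (false ∷ b) = ok h t b

-- The conditions of `isComplete` for a walk that starts at height h, that is, with a surplus of 2h
-- black particles. Adding the surplus to the black side avoids subtraction.
record Good (h : ℕ) (t b : Row) : Set where
  constructor good
  field
    balanced : whites t ℕ.+ whites b ≡ h ℕ.+ h ℕ.+ (blacks t ℕ.+ blacks b)
    prefixes : ∀ j → j ℕ.≤ length t →
      whites (take j t) ℕ.+ whites (take j b) ℕ.≤ h ℕ.+ h ℕ.+ (blacks (take j t) ℕ.+ blacks (take j b))

private
  up₂ : ∀ h a b → h ℕ.+ h ℕ.+ (suc a ℕ.+ suc b) ≡ suc h ℕ.+ suc h ℕ.+ (a ℕ.+ b)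
  up₂ = ℕRing.solve-∀
  up₁ˡ : ∀ h a b → h ℕ.+ h ℕ.+ (suc a ℕ.+ b) ≡ suc (h ℕ.+ h ℕ.+ (a ℕ.+ b))
  up₁ˡ = ℕRing.solve-∀
  up₁ʳ : ∀ h a b → h ℕ.+ h ℕ.+ (a ℕ.+ suc b) ≡ suc (h ℕ.+ h ℕ.+ (a ℕ.+ b))
  up₁ʳ = ℕRing.solve-∀
  down₂ : ∀ h c → suc h ℕ.+ suc h ℕ.+ c ≡ suc (suc (h ℕ.+ h ℕ.+ c))
  down₂ = ℕRing.solve-∀
  suc+suc : ∀ a b → suc a ℕ.+ suc b ≡ suc (suc (a ℕ.+ b))
  suc+suc = ℕRing.solve-∀

ok⇒Good : ∀ h t b → ok h t b ≡ true → Good h t b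
ok⇒Good zero [] [] e = good refl λ { zero _ → z≤n }
ok⇒Good (suc h) [] [] ()
ok⇒Good h (true ∷ t) (true ∷ b) e with ok⇒Good (suc h) t b e
... | good s p = good (trans s (sym (up₂ h (blacks t) (blacks b)))) λ
  { zero _ → z≤n
  ; (suc j) (s≤s j≤) → ℕP.≤-trans (p j j≤) (ℕP.≤-reflexive (sym (up₂ h (blacks (take j t)) (blacks (take j b))))) }
ok⇒Good h (true ∷ t) (false ∷ b) e with ok⇒Good h t b e
... | good s p = good (trans (ℕP.+-suc (whites t) (whites b)) (trans (cong suc s) (sym (up₁ˡ h (blacks t) (blacks b))))) λ
  { zero _ → z≤n
  ; (suc j) (s≤s j≤) → subst₂ ℕ._≤_ (sym (ℕP.+-suc (whites (take j t)) (whites (take j b))))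
      (sym (up₁ˡ h (blacks (take j t)) (blacks (take j b)))) (s≤s (p j j≤)) }
ok⇒Good h (false ∷ t) (true ∷ b) e with ok⇒Good h t b e
... | good s p = good (trans (cong suc s) (sym (up₁ʳ h (blacks t) (blacks b)))) λ
  { zero _ → z≤n
  ; (suc j) (s≤s j≤) → subst (suc (whites (take j t) ℕ.+ whites (take j b)) ℕ.≤_)
      (sym (up₁ʳ h (blacks (take j t)) (blacks (take j b)))) (s≤s (p j j≤)) }
ok⇒Good (suc h) (false ∷ t) (false ∷ b) e with ok⇒Good h t b e
... | good s p = good (trans (suc+suc (whites t) (whites b)) (trans (cong (suc ∘ suc) s) (sym (down₂ h (blacks t ℕ.+ blacks b))))) λ
  { zero _ → z≤n
  ; (suc j) (s≤s j≤) → subst₂ ℕ._≤_ (sym (suc+suc (whites (take j t)) (whites (take j b))))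
      (sym (down₂ h (blacks (take j t) ℕ.+ blacks (take j b)))) (s≤s (s≤s (p j j≤))) }

Good⇒ok : ∀ h t b → length t ≡ length b → Good h t b → ok h t b ≡ true
Good⇒ok zero [] [] _ _ = refl
Good⇒ok (suc h) [] [] _ (good () _)
Good⇒ok h (true ∷ t) (true ∷ b) l (good s p) = Good⇒ok (suc h) t b (ℕP.suc-injective l) (good
  (trans s (up₂ h (blacks t) (blacks b)))
  (λ j j≤ → ℕP.≤-trans (p (suc j) (s≤s j≤)) (ℕP.≤-reflexive (up₂ h (blacks (take j t)) (blacks (take j b))))))
Good⇒ok h (true ∷ t) (false ∷ b) l (good s p) = Good⇒ok h t b (ℕP.suc-injective l) (good
  (ℕP.suc-injective (trans (sym (ℕP.+-suc (whites t) (whites b))) (trans s (up₁ˡ h (blacks t) (blacks b)))))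
  (λ j j≤ → ℕP.≤-pred (subst₂ ℕ._≤_ (ℕP.+-suc (whites (take j t)) (whites (take j b)))
    (up₁ˡ h (blacks (take j t)) (blacks (take j b))) (p (suc j) (s≤s j≤)))))
Good⇒ok h (false ∷ t) (true ∷ b) l (good s p) = Good⇒ok h t b (ℕP.suc-injective l) (good
  (ℕP.suc-injective (trans s (up₁ʳ h (blacks t) (blacks b))))
  (λ j j≤ → ℕP.≤-pred (subst (suc (whites (take j t) ℕ.+ whites (take j b)) ℕ.≤_)
    (up₁ʳ h (blacks (take j t)) (blacks (take j b))) (p (suc j) (s≤s j≤)))))
-- From height 0 a column of two white particles violates the prefix condition of length 1, which
-- reads 2 ≤ 0.
Good⇒ok zero (false ∷ t) (false ∷ b) l (good s p) with p 1 (s≤s z≤n)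
... | ()
Good⇒ok (suc h) (false ∷ t) (false ∷ b) l (good s p) = Good⇒ok h t b (ℕP.suc-injective l) (good
  (ℕP.suc-injective (ℕP.suc-injective (trans (sym (suc+suc (whites t) (whites b))) (trans s (down₂ h (blacks t ℕ.+ blacks b))))))
  (λ j j≤ → ℕP.≤-pred (ℕP.≤-pred (subst₂ ℕ._≤_ (suc+suc (whites (take j t)) (whites (take j b)))
    (down₂ h (blacks (take j t) ℕ.+ blacks (take j b))) (p (suc j) (s≤s j≤))))))

blacks+whites : ∀ r → blacks r ℕ.+ whites r ≡ length r
blacks+whites [] = refl
blacks+whites (true ∷ r) = cong suc (blacks+whites r)
blacks+whites (false ∷ r) = trans (ℕP.+-suc (blacks r) (whites r)) (cong suc (blacks+whites r))

double-injective : ∀ a b → a ℕ.+ a ≡ b ℕ.+ b → a ≡ b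
double-injective zero zero _ = refl
double-injective (suc a) (suc b) e = cong suc (double-injective a b
  (ℕP.suc-injective (trans (sym (ℕP.+-suc a a)) (trans (ℕP.suc-injective e) (ℕP.+-suc b b)))))

T-all⁻ : (p : A → Bool) (xs : List A) → T (all p xs) → ∀ {x} → x ∈ xs → T (p x)
T-all⁻ p (x ∷ xs) pxs (here refl) = proj₁ (Equivalence.to BoolP.T-∧ pxs)
T-all⁻ p (x ∷ xs) pxs (there x∈) = T-all⁻ p xs (proj₂ (Equivalence.to (BoolP.T-∧ {p x}) pxs)) x∈

T-all⁺ : (p : A → Bool) (xs : List A) → (∀ x → x ∈ xs → T (p x)) → T (all p xs)
T-all⁺ p [] _ = _
T-all⁺ p (x ∷ xs) h = Equivalence.from BoolP.T-∧ (h x (here refl) , T-all⁺ p xs (λ y y∈ → h y (there y∈)))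

≡-from-T : ∀ {a b} → (T a → T b) → (T b → T a) → a ≡ b
≡-from-T {true} {true} _ _ = refl
≡-from-T {true} {false} f _ with f _
... | ()
≡-from-T {false} {true} _ g with g _
... | ()
≡-from-T {false} {false} _ _ = refl

-- The walk only knows that black and white particles are equally many. Since there are 2n cells,
-- each colour then occurs n times.
isComplete-ok : ∀ n t b → length t ≡ n → length b ≡ n → isComplete n (t , b) ≡ ok 0 t b
isComplete-ok n t b lt lb = ≡-from-T to from
  where
  to : T (isComplete n (t , b)) → T (ok 0 t b)
  to c with Equivalence.to (BoolP.T-∧ {length t ≡ᵇ n}) c
  ... | _ , c₁ with Equivalence.to (BoolP.T-∧ {length b ≡ᵇ n}) c₁
  ... | _ , c₂ with Equivalence.to (BoolP.T-∧ {(blacks t ℕ.+ blacks b) ≡ᵇ n}) c₂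
  ... | bl , c₃ with Equivalence.to (BoolP.T-∧ {(whites t ℕ.+ whites b) ≡ᵇ n}) c₃
  ... | wh , pre = Equivalence.from BoolP.T-≡ (Good⇒ok 0 t b (trans lt (sym lb)) (good
    (trans (ℕP.≡ᵇ⇒≡ _ _ wh) (sym (ℕP.≡ᵇ⇒≡ _ _ bl)))
    (λ j j≤ → ℕP.≤ᵇ⇒≤ _ _ (T-all⁻ (prefixOK (t , b)) (range 0 n) pre (∈-range⁺ (subst (j ℕ.≤_) lt j≤))))))
  from : T (ok 0 t b) → T (isComplete n (t , b))
  from o with ok⇒Good 0 t b (Equivalence.to BoolP.T-≡ o)
  ... | good s p =
    Equivalence.from BoolP.T-∧ (ℕP.≡⇒≡ᵇ _ _ lt , Equivalence.from BoolP.T-∧ (ℕP.≡⇒≡ᵇ _ _ lb ,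
    Equivalence.from BoolP.T-∧ (ℕP.≡⇒≡ᵇ _ _ bl≡n , Equivalence.from BoolP.T-∧ (ℕP.≡⇒≡ᵇ _ _ (trans s bl≡n) ,
    T-all⁺ (prefixOK (t , b)) (range 0 n) (λ j j∈ → ℕP.≤⇒≤ᵇ (p j (subst (j ℕ.≤_) (sym lt) (∈-range⁻ j∈))))))))
    where
    interchange : ∀ a b c d → (a ℕ.+ b) ℕ.+ (c ℕ.+ d) ≡ (a ℕ.+ c) ℕ.+ (b ℕ.+ d)
    interchange = ℕRing.solve-∀
    bl≡n : blacks t ℕ.+ blacks b ≡ n
    bl≡n = double-injective (blacks t ℕ.+ blacks b) n (trans (cong ((blacks t ℕ.+ blacks b) ℕ.+_) (sym s))
      (trans (interchange (blacks t) (blacks b) (whites t) (whites b))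
        (cong₂ ℕ._+_ (trans (blacks+whites t) lt) (trans (blacks+whites b) lb))))

∈-filter⁻ : (p : A → Bool) (xs : List A) → ∀ {x} → x ∈ boolFilter p xs → x ∈ xs × p x ≡ true
∈-filter⁻ p (y ∷ xs) x∈ with p y in eq
∈-filter⁻ p (y ∷ xs) (here refl) | true = here refl , eq
∈-filter⁻ p (y ∷ xs) (there x∈) | true = there (proj₁ (∈-filter⁻ p xs x∈)) , proj₂ (∈-filter⁻ p xs x∈)
∈-filter⁻ p (y ∷ xs) x∈ | false = there (proj₁ (∈-filter⁻ p xs x∈)) , proj₂ (∈-filter⁻ p xs x∈)

∈-filter⁺ : (p : A → Bool) (xs : List A) → ∀ {x} → x ∈ xs → p x ≡ true → x ∈ boolFilter p xs
∈-filter⁺ p (y ∷ xs) (here refl) e with p y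
∈-filter⁺ p (y ∷ xs) (here refl) refl | true = here refl
∈-filter⁺ p (y ∷ xs) (there x∈) e with p y
... | true = there (∈-filter⁺ p xs x∈ e)
... | false = ∈-filter⁺ p xs x∈ e

∈-Ω⁻ : ∀ n {t b} → (t , b) ∈ Ω n → length t ≡ n × length b ≡ n × ok 0 t b ≡ true
∈-Ω⁻ n {t} {b} ω∈ with ∈-filter⁻ (isComplete n) (concatMap (λ t → map (λ b → (t , b)) (rows n)) (rows n)) ω∈
... | ω∈′ , c with find (∈P.∈-concatMap⁻ (λ t → map (λ b → (t , b)) (rows n)) {xs = rows n} ω∈′)
... | t′ , t∈ , tb∈ with ∈P.∈-map⁻ (λ b → (t′ , b)) tb∈
... | b′ , b∈ , refl = ∈-rows⁻ n t∈ , ∈-rows⁻ n b∈ , trans (sym (isComplete-ok n t b (∈-rows⁻ n t∈) (∈-rows⁻ n b∈))) c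

∈-Ω⁺ : ∀ n {t b} → length t ≡ n → length b ≡ n → ok 0 t b ≡ true → (t , b) ∈ Ω n
∈-Ω⁺ n {t} {b} lt lb o = ∈-filter⁺ (isComplete n) (concatMap (λ t → map (λ b → (t , b)) (rows n)) (rows n))
  (∈P.∈-concatMap⁺ (λ t → map (λ b → (t , b)) (rows n))
    (Any.map (λ { refl → ∈P.∈-map⁺ (λ b → (t , b)) (subst (λ m → b ∈ rows m) lb (∈-rows⁺ b)) })
      (subst (λ m → t ∈ rows m) lt (∈-rows⁺ t))))
  (trans (isComplete-ok n t b lt lb) o)

Σ-Ω : ∀ n (F : Conf → ℚ) → Σ[ Ω n ] F ≡ Σ[ rows n ] (λ t → Σ[ rows n ] (λ b → ind (ok 0 t b) * F (t , b)))
Σ-Ω n F = trans (Σ-filter (isComplete n) (concatMap (λ t → map (λ b → (t , b)) (rows n)) (rows n)) F)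
  (trans (Σ-concatMap (λ t → map (λ b → (t , b)) (rows n)) (rows n) (λ ω → ind (isComplete n ω) * F ω))
    (Σ-cong-∈ (rows n) (λ t t∈ → trans (Σ-map (λ b → (t , b)) (rows n) (λ ω → ind (isComplete n ω) * F ω))
      (Σ-cong-∈ (rows n) (λ b b∈ → cong (λ o → ind o * F (t , b)) (isComplete-ok n t b (∈-rows⁻ n t∈) (∈-rows⁻ n b∈)))))))

confEq-rowEq : ∀ t b t′ b′ → confEq (t , b) (t′ , b′) ≡ rowEq t t′ ∧ rowEq b b′
confEq-rowEq t b t′ b′ with ListP.≡-dec BoolP._≟_ t t′
... | yes refl = refl
... | no _ = refl

Ω-Δ : ∀ n z → z ∈ Ω n → (g : Conf → ℚ) → Σ[ Ω n ] (λ y → ind (confEq z y) * g y) ≡ g z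
Ω-Δ n z@(t , b) z∈ g with ∈-Ω⁻ n z∈
... | lt , lb , o = trans (Σ-Ω n (λ y → ind (confEq z y) * g y))
  (trans (Σ-cong (rows n) (λ t′ → trans
      (Σ-cong (rows n) (λ b′ → trans
        (cong (λ e → ind (ok 0 t′ b′) * (e * g (t′ , b′))) (trans (cong ind (confEq-rowEq t b t′ b′)) (ind-∧ (rowEq t t′) (rowEq b b′))))
        (regroup (ind (ok 0 t′ b′)) (ind (rowEq t t′)) (ind (rowEq b b′)) (g (t′ , b′)))))
      (Σ-*ˡ (rows n) (ind (rowEq t t′)) (λ b′ → ind (rowEq b b′) * (ind (ok 0 t′ b′) * g (t′ , b′))))))
    (trans (rows-Δ n t (subst (λ m → t ∈ rows m) lt (∈-rows⁺ t)) (λ t′ → Σ[ rows n ] (λ b′ → ind (rowEq b b′) * (ind (ok 0 t′ b′) * g (t′ , b′)))))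
      (trans (rows-Δ n b (subst (λ m → b ∈ rows m) lb (∈-rows⁺ b)) (λ b′ → ind (ok 0 t b′) * g (t , b′)))
        (trans (cong (λ o → ind o * g (t , b)) o) (ℚP.*-identityˡ (g (t , b)))))))
  where
  regroup : ∀ o p q g → o * ((p * q) * g) ≡ p * (q * (o * g))
  regroup = solve-∀ ℚ-ring

-- The map T

-- The premise covers all heights because the column put in front may change the height at which the
-- rest starts.
ok-cong : ∀ {t b t′ b′} → (∀ h → ok h t b ≡ ok h t′ b′) → ∀ h x y → ok h (x ∷ t) (y ∷ b) ≡ ok h (x ∷ t′) (y ∷ b′)
ok-cong e h true true = e (suc h)
ok-cong e h true false = e h
ok-cong e h false true = e h
ok-cong e zero false false = refl
ok-cong e (suc h) false false = e h

ok-neutral : ∀ h x t b → ok h (x ∷ t) (not x ∷ b) ≡ ok h t b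
ok-neutral h true t b = refl
ok-neutral h false t b = refl

-- A column with two different particles leaves the height unchanged, so its place does not matter.
ok-insertAt : ∀ j x t b → length t ≡ length b → ∀ h → ok h (insertAt j x t) (insertAt j (not x) b) ≡ ok h t b
ok-insertAt zero x t b l h = ok-neutral h x t b
ok-insertAt (suc j) x [] [] l h = ok-neutral h x [] []
ok-insertAt (suc j) x (y ∷ t) (z ∷ b) l h = ok-cong (ok-insertAt j x t b (ℕP.suc-injective l)) h y z

ok-removeAt : ∀ j x t b → length t ≡ length b → j ℕ.< length t → get t (suc j) ≡ x → get b (suc j) ≡ not x →
  ∀ h → ok h (removeAt j t) (removeAt j b) ≡ ok h t b
ok-removeAt zero x (x ∷ t) (y ∷ b) l j< refl refl h = sym (ok-neutral h x t b)
ok-removeAt (suc j) x (y ∷ t) (z ∷ b) l (s≤s j<) p q h = ok-cong (ok-removeAt j x t b (ℕP.suc-injective l) j< p q) h y z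

length-insertAt : ∀ j x (t : Row) → length (insertAt j x t) ≡ suc (length t)
length-insertAt zero x t = refl
length-insertAt (suc j) x [] = refl
length-insertAt (suc j) x (y ∷ t) = cong suc (length-insertAt j x t)

length-removeAt : ∀ j (t : Row) → j ℕ.< length t → suc (length (removeAt j t)) ≡ length t
length-removeAt zero (x ∷ t) _ = refl
length-removeAt (suc j) (x ∷ t) (s≤s j<) = cong suc (length-removeAt j t j<)

length-insert-remove : ∀ j x k (t : Row) → k ℕ.< length t → length (insertAt j x (removeAt k t)) ≡ length t
length-insert-remove j x k t k< = trans (length-insertAt j x (removeAt k t)) (length-removeAt k t k<)

-- Within a run of its own colour the place of a new particle is invisible. For this reason the long
-- moves of `T` look like nearest-neighbour moves in the top row.
insertAt-run : ∀ j k x t → j ℕ.≤ k → k ℕ.≤ length t → (∀ c → j ℕ.≤ c → c ℕ.< k → get t (suc c) ≡ x) →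
  insertAt j x t ≡ insertAt k x t
insertAt-run zero zero x t _ _ _ = refl
insertAt-run zero (suc k) x (y ∷ t) _ (s≤s k≤) run =
  cong₂ _∷_ (sym (run 0 z≤n (s≤s z≤n))) (trans (cong (_∷ t) (run 0 z≤n (s≤s z≤n)))
    (insertAt-run zero k x t z≤n k≤ (λ c _ c< → run (suc c) z≤n (s≤s c<))))
insertAt-run (suc j) (suc k) x (y ∷ t) (s≤s j≤) (s≤s k≤) run =
  cong (y ∷_) (insertAt-run j k x t j≤ k≤ (λ c j≤c c<k → run (suc c) (s≤s j≤c) (s≤s c<k)))

get-removeAt-< : ∀ k t c → c ℕ.< k → get (removeAt k t) (suc c) ≡ get t (suc c)
get-removeAt-< k [] c _ = refl
get-removeAt-< (suc k) (x ∷ t) zero _ = refl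
get-removeAt-< (suc k) (x ∷ t) (suc c) (s≤s c<) = get-removeAt-< k t c c<

get-removeAt-≥ : ∀ k t c → k ℕ.≤ c → get (removeAt k t) (suc c) ≡ get t (suc (suc c))
get-removeAt-≥ k [] c _ = refl
get-removeAt-≥ zero (x ∷ t) c _ = refl
get-removeAt-≥ (suc k) (x ∷ t) (suc c) (s≤s k≤) = get-removeAt-≥ k t c k≤

swap-white : ∀ i t → suc i ℕ.< length t → get t (suc i) ≡ true →
  insertAt i false (removeAt (suc i) t) ≡ setAt i false (setAt (suc i) true t)
swap-white zero (true ∷ y ∷ t) _ refl = refl
swap-white zero (x ∷ []) (s≤s ()) _
swap-white (suc i) (x ∷ t) (s≤s i<) p = cong (x ∷_) (swap-white i t i< p)

swap-black : ∀ i t → suc i ℕ.< length t → get t (suc (suc i)) ≡ false →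
  insertAt (suc i) true (removeAt i t) ≡ setAt i false (setAt (suc i) true t)
swap-black zero (x ∷ false ∷ t) _ refl = refl
swap-black zero (x ∷ []) (s≤s ()) _
swap-black (suc i) (x ∷ t) (s≤s i<) p = cong (x ∷_) (swap-black i t i< p)

replace-at : ∀ i x (t : Row) → i ℕ.< length t → insertAt i x (removeAt i t) ≡ setAt i x t
replace-at zero x (y ∷ t) _ = refl
replace-at (suc i) x (y ∷ t) (s≤s i<) = cong (y ∷_) (replace-at i x t i<)

-- The walk ends at height 0 without falling below it, so its last column cannot be a rise.
ok-last : ∀ h m t b → length t ≡ suc m → length t ≡ length b → ok h t b ≡ true →
  get t (suc m) ≡ true → get b (suc m) ≡ false
ok-last h zero (true ∷ []) (false ∷ []) _ _ _ _ = refl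
ok-last h zero (true ∷ []) (true ∷ []) _ _ () _
ok-last h (suc m) (true ∷ t) (true ∷ b) l l′ o p = ok-last (suc h) m t b (ℕP.suc-injective l) (ℕP.suc-injective l′) o p
ok-last h (suc m) (true ∷ t) (false ∷ b) l l′ o p = ok-last h m t b (ℕP.suc-injective l) (ℕP.suc-injective l′) o p
ok-last h (suc m) (false ∷ t) (true ∷ b) l l′ o p = ok-last h m t b (ℕP.suc-injective l) (ℕP.suc-injective l′) o p
ok-last (suc h) (suc m) (false ∷ t) (false ∷ b) l l′ o p = ok-last h m t b (ℕP.suc-injective l) (ℕP.suc-injective l′) o p

-- The zero-based place of the white particle inserted below in cases (a'') and (b), with `k` for j₂
-- and `l` for n.
bpos : ℕ → ℕ → ℕ
bpos k l = if k <ᵇ l then k else l ℕ.∸ 1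

bpos-suc : ∀ k l → bpos (suc k) (suc (suc l)) ≡ suc (bpos k (suc l))
bpos-suc k l with k <ᵇ suc l
... | true = refl
... | false = refl

-- Inserting ∘ below and • above shifts the bottom row by one column along a run of • of the top row;
-- all heights are restored at the white top cell that ends the run.
ok-shift : ∀ j t b → length t ≡ length b → j ℕ.≤ length t →
  (∀ c → c ℕ.< j → get t (suc c) ≡ true) → (j ℕ.< length t → get t (suc j) ≡ false) →
  ∀ h → ok h (insertAt j true t) (insertAt (bpos (suc j) (suc (length t))) false b) ≡ ok h t b
-- The run reaches the right border. The bottom place falls back to the last index, and the new
-- column • over ∘ is neutral.
ok-shift zero [] [] l j≤ run end h = refl
ok-shift zero (x ∷ t) (z ∷ b) l j≤ run end h with end (s≤s z≤n)
-- The column ∘ over z becomes • over z followed by ∘ over ∘. For black z this is a rise and a fall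
-- in place of a neutral column; for white z, a neutral column and a fall in place of a fall.
ok-shift zero (false ∷ t) (true ∷ b) l j≤ run end h | refl = refl
ok-shift zero (false ∷ t) (false ∷ b) l j≤ run end h | refl = refl
ok-shift (suc j) (x ∷ t) (z ∷ b) l (s≤s j≤) run end h =
  trans (cong (λ k → ok h (x ∷ insertAt j true t) (insertAt k false (z ∷ b))) (bpos-suc (suc j) (length t)))
    (ok-cong (ok-shift j t b (ℕP.suc-injective l) j≤ (λ c c< → run (suc c) (s≤s c<)) (λ j< → end (s≤s j<))) h x z)

-- Case (a''): the deletions merge the columns • over z and ∘ over ∘ into ∘ over z, with the same
-- effect on the height. The insertions further right are then harmless by `ok-shift`.
ok-shift-at : ∀ i j t b → length t ≡ length b → suc (suc (i ℕ.+ j)) ℕ.≤ length t →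
  get t (suc i) ≡ true → get t (suc (suc i)) ≡ false → get b (suc (suc i)) ≡ false →
  (∀ c → c ℕ.< j → get t (suc (suc (suc (i ℕ.+ c)))) ≡ true) →
  (suc (suc (i ℕ.+ j)) ℕ.< length t → get t (suc (suc (suc (i ℕ.+ j)))) ≡ false) →
  ∀ h → ok h (insertAt (suc (i ℕ.+ j)) true (removeAt i t))
             (insertAt (bpos (suc (suc (i ℕ.+ j))) (length t)) false (removeAt (suc i) b)) ≡ ok h t b
ok-shift-at zero j (true ∷ false ∷ t) (z ∷ false ∷ b) l (s≤s (s≤s j≤)) refl refl refl run end h =
  trans (cong (λ k → ok h (false ∷ insertAt j true t) (insertAt k false (z ∷ b))) (bpos-suc (suc j) (length t))) (first h z)
  where
  shifted : ∀ h → ok h (insertAt j true t) (insertAt (bpos (suc j) (suc (length t))) false b) ≡ ok h t b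
  shifted = ok-shift j t b (ℕP.suc-injective (ℕP.suc-injective l)) j≤ run (λ j< → end (s≤s (s≤s j<)))
  first : ∀ h z → ok h (false ∷ insertAt j true t) (z ∷ insertAt (bpos (suc j) (suc (length t))) false b) ≡
    ok h (true ∷ false ∷ t) (z ∷ false ∷ b)
  first h true = shifted h
  first zero false = refl
  first (suc h) false = shifted h
ok-shift-at (suc i) j (x ∷ []) (z ∷ b) l (s≤s ()) _ _ _ _ _ h
ok-shift-at (suc i) j (x ∷ t@(_ ∷ t′)) (z ∷ b) l (s≤s j≤) p q r run end h =
  trans (cong (λ k → ok h (x ∷ insertAt (suc (i ℕ.+ j)) true (removeAt i t)) (insertAt k false (z ∷ removeAt (suc i) b)))
      (bpos-suc (suc (suc (i ℕ.+ j))) (length t′)))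
    (ok-cong (ok-shift-at i j t b (ℕP.suc-injective l) j≤ p q r run (λ j< → end (s≤s j<))) h x z)

-- The searches for the insertion points

record Smallest (p : ℕ → Bool) (hi r : ℕ) : Set where
  constructor smallest-at
  field
    hit-or-hi : p r ≡ true ⊎ r ≡ hi
    ≤hi : r ℕ.≤ hi

-- The recursion inside smallest is a local function of Defs; the metavariable stands for it.
mutual
  smallest-loop : (ℕ → Bool) → ℕ → ℕ → List ℕ → ℕ
  smallest-loop = _

  smallest-spec : ∀ p lo hi → Smallest p hi (smallest p lo hi)
  -- With the range replaced by a variable, the goal applies the local loop to distinct variables,
  -- and this determines the metavariable.
  smallest-spec p lo hi with range lo hi | range-≤ lo hi
  ... | xs | xs≤hi = smallest-go p lo hi xs xs≤hi

  smallest-go : ∀ p lo hi xs → (∀ {x} → x ∈ xs → x ℕ.≤ hi) → Smallest p hi (smallest-loop p lo hi xs)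
  smallest-go p lo hi [] _ = smallest-at (inj₂ refl) ℕP.≤-refl
  smallest-go p lo hi (x ∷ xs) xs≤hi with p x in eq
  ... | true = smallest-at (inj₁ eq) (xs≤hi (here refl))
  ... | false = smallest-go p lo hi xs (λ x∈ → xs≤hi (there x∈))

  range-≤ : ∀ lo hi {x} → x ∈ range lo hi → x ℕ.≤ hi
  range-≤ lo hi x∈ with ∈P.∈-applyUpTo⁻ (lo ℕ.+_) x∈
  ... | k , k< , refl = ℕP.≤-pred (subst (ℕ._≤ suc hi) (ℕP.+-suc lo k)
    (ℕP.≤-trans (ℕP.+-monoʳ-≤ lo k<) (ℕP.≤-reflexive (ℕP.m+[n∸m]≡n {lo} {suc hi} (ℕP.<⇒≤ (ℕP.m∸n≢0⇒n<m {suc hi} {lo} (λ e → ℕP.<⇒≢ (ℕP.≤-<-trans z≤n k<) (sym e))))))))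

record Largest (p : ℕ → Bool) (lo hi r : ℕ) : Set where
  constructor largest-at
  field
    lo≤ : lo ℕ.≤ r
    ≤hi : r ℕ.≤ hi
    holds : p r ≡ true
    maximal : r ℕ.< hi → p (suc r) ≡ false

mutual
  largest-loop : (ℕ → Bool) → ℕ → ℕ → List ℕ → ℕ
  largest-loop = _

  largest-unfold : ∀ p lo hi → largest p lo hi ≡ largest-loop p lo hi (reverse (range lo hi))
  largest-unfold p lo hi with reverse (range lo hi)
  ... | xs = refl

-- The reversed range is scanned downwards from lo + m - 1, and `above` remembers that the value
-- just passed failed; this becomes maximality at the first success. The scan cannot run out,
-- because `p` holds at `lo`.
largest-go : ∀ p lo hi m → lo ℕ.≤ hi → p lo ≡ true → lo ℕ.+ m ℕ.≤ suc hi → (lo ℕ.+ m ℕ.≤ hi → p (lo ℕ.+ m) ≡ false) →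
  Largest p lo hi (largest-loop p lo hi (applyDownFrom (lo ℕ.+_) m))
largest-go p lo hi zero lo≤hi plo _ above with trans (sym plo) (subst (λ k → p k ≡ false) (ℕP.+-identityʳ lo)
  (above (subst (ℕ._≤ hi) (sym (ℕP.+-identityʳ lo)) lo≤hi)))
... | ()
largest-go p lo hi (suc m) lo≤hi plo m≤ above with p (lo ℕ.+ m) in eq
... | true = largest-at (ℕP.m≤m+n lo m) (ℕP.≤-pred (subst (ℕ._≤ suc hi) (ℕP.+-suc lo m) m≤)) eq
  (λ r< → subst (λ k → p k ≡ false) (ℕP.+-suc lo m) (above (subst (ℕ._≤ hi) (sym (ℕP.+-suc lo m)) r<)))
... | false = largest-go p lo hi m lo≤hi plo (ℕP.≤-trans (ℕP.+-monoʳ-≤ lo (ℕP.n≤1+n m)) m≤) (λ _ → eq)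

largest-spec : ∀ p lo hi → lo ℕ.≤ hi → p lo ≡ true → Largest p lo hi (largest p lo hi)
largest-spec p lo hi lo≤hi plo = subst (Largest p lo hi)
  (sym (trans (largest-unfold p lo hi) (cong (largest-loop p lo hi) (ListP.reverse-applyUpTo (lo ℕ.+_) (suc hi ℕ.∸ lo)))))
  (largest-go p lo hi (suc hi ℕ.∸ lo) lo≤hi plo (ℕP.≤-reflexive end) (λ le → ⊥-elim (ℕP.<-irrefl refl (subst (ℕ._≤ hi) end le))))
  where
  end : lo ℕ.+ (suc hi ℕ.∸ lo) ≡ suc hi
  end = ℕP.m+[n∸m]≡n (ℕP.m≤n⇒m≤1+n lo≤hi)

all-range⁻ : ∀ p a b → all p (range a b) ≡ true → ∀ c → a ℕ.≤ c → c ℕ.≤ b → p c ≡ true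
all-range⁻ p a b h c a≤c c≤b = Equivalence.to BoolP.T-≡ (T-all⁻ p (range a b) (Equivalence.from BoolP.T-≡ h)
  (subst (_∈ range a b) (ℕP.m+[n∸m]≡n a≤c) (∈P.∈-applyUpTo⁺ (a ℕ.+_) (ℕP.∸-monoˡ-< (s≤s c≤b) a≤c))))

all-range-empty : ∀ p a → all p (range (suc a) a) ≡ true
all-range-empty p a = cong (λ m → all p (applyUpTo (suc a ℕ.+_) m)) (ℕP.n∸n≡0 a)

all-range-maximal : ∀ p a b → a ℕ.≤ suc b → all p (range a b) ≡ true → all p (range a (suc b)) ≡ false → p (suc b) ≡ false
all-range-maximal p a b a≤ h h′ with p (suc b) in eq
... | false = refl
... | true = trans (sym (Equivalence.to BoolP.T-≡ (T-all⁺ p (range a (suc b)) extended))) h′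
  where
  extended : ∀ c → c ∈ range a (suc b) → T (p c)
  extended c c∈ with ∈P.∈-applyUpTo⁻ (a ℕ.+_) c∈
  ... | k , _ , refl with ℕP.m≤n⇒m<n∨m≡n (range-≤ a (suc b) c∈)
  ... | inj₁ c< = Equivalence.from BoolP.T-≡ (all-range⁻ p a b h (a ℕ.+ k) (ℕP.m≤m+n a k) (ℕP.≤-pred c<))
  ... | inj₂ c≡ = Equivalence.from BoolP.T-≡ (trans (cong p c≡) eq)

-- The insertion point of a white top cell: moving it along the run of ∘ does not change the top row.
white-run : ∀ t i → let j = smallest (λ j → allWhite t (suc j) i) 0 i in
  j ℕ.≤ i × (∀ c → j ℕ.≤ c → c ℕ.< i → get t (suc c) ≡ false)
white-run t i with smallest-spec (λ j → allWhite t (suc j) i) 0 i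
... | smallest-at h j≤i = j≤i , λ c j≤c c<i → BoolP.not-injective {y = false} (run h c j≤c c<i)
  where
  j = smallest (λ j → allWhite t (suc j) i) 0 i
  run : (allWhite t (suc j) i ≡ true ⊎ j ≡ i) → ∀ c → j ℕ.≤ c → c ℕ.< i → not (get t (suc c)) ≡ true
  run (inj₁ h) c j≤c c<i = all-range⁻ (λ c → not (get t c)) (suc j) i h (suc c) (s≤s j≤c) c<i
  run (inj₂ j≡i) c j≤c c<i = ⊥-elim (ℕP.<-irrefl refl (ℕP.<-≤-trans (subst (c ℕ.<_) (sym j≡i) c<i) j≤c))

-- The result of the search as an offset: j is the length of the black run after cell lo + 1, which
-- ends at a white cell or at the border. The search succeeds because the empty run always
-- qualifies.
black-run : ∀ t lo → suc lo ℕ.≤ length t → let r = largest (λ j → allBlack t (suc (suc lo)) j) (suc lo) (length t) in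
  ∃ λ j → r ≡ suc (lo ℕ.+ j) × suc (lo ℕ.+ j) ℕ.≤ length t ×
    (∀ c → c ℕ.< j → get t (suc (suc (lo ℕ.+ c))) ≡ true) ×
    (suc (lo ℕ.+ j) ℕ.< length t → get t (suc (suc (lo ℕ.+ j))) ≡ false)
black-run t lo lo< with largest-spec (λ j → allBlack t (suc (suc lo)) j) (suc lo) (length t) lo< (all-range-empty (get t) (suc lo))
... | largest-at lo≤ ≤hi holds maximal with ℕP.m≤n⇒∃[o]m+o≡n lo≤
... | j , e = j , sym e , subst (ℕ._≤ length t) (sym e) ≤hi ,
  (λ c c< → all-range⁻ (get t) (suc (suc lo)) _ holds (suc (suc (lo ℕ.+ c))) (s≤s (s≤s (ℕP.m≤m+n lo c)))
    (subst (suc (suc (lo ℕ.+ c)) ℕ.≤_) e (s≤s (ℕP.+-monoʳ-< lo c<)))) ,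
  (λ r< → trans (cong (get t ∘ suc) e) (all-range-maximal (get t) (suc (suc lo)) _
    (s≤s lo≤) holds (maximal (subst (ℕ._< length t) e r<))))

-- `top≡` is the projection to the TASEP; the other two fields keep the new configuration complete.
record Lifts (t b : Row) (ω : Conf) (τ : Row) : Set where
  constructor lifts
  field
    top≡ : top ω ≡ τ
    length≡ : length (proj₂ ω) ≡ length b
    ok≡ : ok 0 (top ω) (proj₂ ω) ≡ ok 0 t b

-- Case (a'): the moved column ∘ over • is neutral. On top its ∘ joins the white run that ends just
-- left of the black particle, which amounts to exchanging the two.
pull-white : ∀ t b i → length t ≡ length b → suc i ℕ.< length t →
  get t (suc i) ≡ true → get t (suc (suc i)) ≡ false → get b (suc (suc i)) ≡ true →
  let j = smallest (λ j → allWhite t (suc j) i) 0 i in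
  Lifts t b (insertAt j false (removeAt (suc i) t) , insertAt j true (removeAt (suc i) b)) (setAt i false (setAt (suc i) true t))
pull-white t b i l i< p q r = lifts
  (trans (insertAt-run j i false (removeAt (suc i) t) (proj₁ (white-run t i))
      (ℕP.≤-pred (subst (suc i ℕ.≤_) (sym (length-removeAt (suc i) t i<)) (ℕP.<⇒≤ i<)))
      (λ c j≤c c<i → trans (get-removeAt-< (suc i) t c (ℕP.m<n⇒m<1+n c<i)) (proj₂ (white-run t i) c j≤c c<i)))
    (swap-white i t i< p))
  (length-insert-remove j true (suc i) b (subst (suc i ℕ.<_) l i<))
  (trans (ok-insertAt j false (removeAt (suc i) t) (removeAt (suc i) b)
      (ℕP.suc-injective (trans (length-removeAt (suc i) t i<) (trans l (sym (length-removeAt (suc i) b (subst (suc i ℕ.<_) l i<)))))) 0)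
    (ok-removeAt (suc i) false t b l i< q r 0))
  where
  j = smallest (λ j → allWhite t (suc j) i) 0 i

-- Case (a''): on top the black particle passes the white one and then a run of its own colour,
-- which again amounts to an exchange.
push-black : ∀ t b i r → length t ≡ length b → suc i ℕ.< length t →
  get t (suc i) ≡ true → get t (suc (suc i)) ≡ false → get b (suc (suc i)) ≡ false →
  (∃ λ j → r ≡ suc (suc i ℕ.+ j) × suc (suc i ℕ.+ j) ℕ.≤ length t ×
    (∀ c → c ℕ.< j → get t (suc (suc (suc i ℕ.+ c))) ≡ true) ×
    (suc (suc i ℕ.+ j) ℕ.< length t → get t (suc (suc (suc i ℕ.+ j))) ≡ false)) →
  Lifts t b (insertAt (r ℕ.∸ 1) true (removeAt i t) , insertAt (bpos r (length t)) false (removeAt (suc i) b))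
    (setAt i false (setAt (suc i) true t))
push-black t b i r l i< p q s (j , refl , j≤ , run , end) = lifts
  (trans (sym (insertAt-run (suc i) (suc i ℕ.+ j) true (removeAt i t) (ℕP.m≤m+n (suc i) j)
      (ℕP.≤-pred (subst (suc (suc (i ℕ.+ j)) ℕ.≤_) (sym (length-removeAt i t (ℕP.<-trans (ℕP.n<1+n i) i<))) j≤))
      moved-run))
    (swap-black i t i< q))
  (length-insert-remove (bpos (suc (suc i ℕ.+ j)) (length t)) false (suc i) b (subst (suc i ℕ.<_) l i<))
  (ok-shift-at i j t b l j≤ p q s run end 0)
  where
  moved-run : ∀ c → suc i ℕ.≤ c → c ℕ.< suc i ℕ.+ j → get (removeAt i t) (suc c) ≡ true
  moved-run c i<c c< with ℕP.m≤n⇒∃[o]m+o≡n i<c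
  ... | o , refl = trans (get-removeAt-≥ i t (suc (i ℕ.+ o)) (ℕP.m≤n⇒m≤1+n (ℕP.m≤m+n i o)))
    (run o (ℕP.+-cancelˡ-< (suc i) o j c<))

-- Case (b): a complete configuration cannot begin with two white particles, so the deleted column
-- is the neutral ∘ over •.
enter-black : ∀ t b r → length t ≡ length b →
  (∃ λ j → r ≡ suc j × suc j ℕ.≤ suc (length t) × (∀ c → c ℕ.< j → get t (suc c) ≡ true) ×
    (suc j ℕ.< suc (length t) → get t (suc j) ≡ false)) →
  Lifts (false ∷ t) (true ∷ b) (insertAt (r ℕ.∸ 1) true t , insertAt (bpos r (suc (length t))) false b) (true ∷ t)
enter-black t b r l (j , refl , s≤s j≤ , run , end) = lifts
  (sym (insertAt-run 0 j true t z≤n j≤ (λ c _ c< → run c c<)))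
  (length-insertAt (bpos (suc j) (suc (length t))) false b)
  (ok-shift j t b l j≤ run (λ j< → end (s≤s j<)) 0)

-- Case (c): by `ok-last` the deleted column is • over ∘, and the inserted ∘ over • is neutral as
-- well.
exit-black : ∀ t b m → length t ≡ suc m → length t ≡ length b → ok 0 t b ≡ true → get t (suc m) ≡ true →
  let j = smallest (λ j → allWhite t (suc j) m) 0 m in
  Lifts t b (insertAt j false (removeAt m t) , insertAt j true (removeAt m b)) (setAt m false t)
exit-black t b m e l o p = lifts
  (trans (insertAt-run j m false (removeAt m t) (proj₁ (white-run t m))
      (ℕP.≤-reflexive (ℕP.suc-injective (trans (sym e) (sym (length-removeAt m t m<)))))
      (λ c j≤c c<m → trans (get-removeAt-< m t c c<m) (proj₂ (white-run t m) c j≤c c<m)))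
    (replace-at m false t m<))
  (length-insert-remove j true m b (subst (m ℕ.<_) l m<))
  (trans (ok-insertAt j false (removeAt m t) (removeAt m b)
      (ℕP.suc-injective (trans (length-removeAt m t m<) (trans l (sym (length-removeAt m b (subst (m ℕ.<_) l m<)))))) 0)
    (ok-removeAt m true t b l m< p (ok-last 0 m t b e l o p) 0))
  where
  j = smallest (λ j → allWhite t (suc j) m) 0 m
  m< : m ℕ.< length t
  m< = ℕP.≤-reflexive (sym e)

Tmap-lifts : ∀ n t b i → length t ≡ n → length t ≡ length b → 1 ℕ.≤ n → ok 0 t b ≡ true → i ℕ.≤ n →
  Lifts t b (Tmap n (t , b) i) (tasepMove n t i)
Tmap-lifts n [] b zero refl l () o i≤
Tmap-lifts n (true ∷ t) b zero refl l 1≤ o i≤ = lifts refl refl refl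
Tmap-lifts n (false ∷ t) (false ∷ b) zero refl l 1≤ () i≤
Tmap-lifts n (false ∷ t) (true ∷ b) zero refl l 1≤ o i≤ with enter-black t b
  (largest (λ j → allBlack (false ∷ t) 2 j) 1 (suc (length t))) (ℕP.suc-injective l) (black-run (false ∷ t) 0 (s≤s z≤n))
... | lifts u v w = lifts u (trans v refl) w
Tmap-lifts n t b (suc i) lt l 1≤ o i≤ with suc i ≡ᵇ n in e₁
... | true with ℕP.≡ᵇ⇒≡ (suc i) n (Equivalence.from BoolP.T-≡ e₁)
...   | refl with get t (suc i) in e₂
...     | true = exit-black t b i lt l o e₂
...     | false = lifts refl refl refl
Tmap-lifts n t b (suc i) refl l 1≤ o i≤ | false with get t (suc i) in p | get t (suc (suc i)) in q
...   | true | true = lifts refl refl refl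
...   | false | _ = lifts refl refl refl
...   | true | false with get b (suc (suc i)) in r
...     | true = pull-white t b i l i< p q r
  where
  i< : suc i ℕ.< length t
  i< = ℕP.≤∧≢⇒< i≤ (λ e → BoolP.not-¬ (Equivalence.to BoolP.T-≡ (ℕP.≡⇒≡ᵇ (suc i) (length t) e)) e₁)
...     | false = push-black t b i (largest (λ j → allBlack t (suc (suc (suc i))) j) (suc (suc i)) (length t)) l i< p q r
    (black-run t (suc i) i<)
  where
  i< : suc i ℕ.< length t
  i< = ℕP.≤∧≢⇒< i≤ (λ e → BoolP.not-¬ (Equivalence.to BoolP.T-≡ (ℕP.≡⇒≡ᵇ (suc i) (length t) e)) e₁)

Ω-closed : ∀ n → 1 ℕ.≤ n → ∀ ω i → ω ∈ Ω n → i ℕ.≤ n → Tmap n ω i ∈ Ω n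
Ω-closed n 1≤ ω@(t , b) i ω∈ i≤ with ∈-Ω⁻ n ω∈
... | lt , lb , o with Tmap-lifts n t b i lt (trans lt (sym lb)) 1≤ o i≤
... | lifts u v w = ∈-Ω⁺ n
  (trans (cong length u) (∈-rows⁻ n (rows-closed n t i (subst (λ m → t ∈ rows m) lt (∈-rows⁺ t)) i≤)))
  (trans v lb) (trans w o)

top-Tmap : ∀ n → 1 ℕ.≤ n → ∀ ω i → ω ∈ Ω n → i ℕ.≤ n → top (Tmap n ω i) ≡ tasepMove n (top ω) i
top-Tmap n 1≤ ω@(t , b) i ω∈ i≤ with ∈-Ω⁻ n ω∈
... | lt , lb , o = Lifts.top≡ (Tmap-lifts n t b i lt (trans lt (sym lb)) 1≤ o i≤)

-- Counting complete configurations

-- In matrix language, the entry at height h of the product of D's and E's along τ applied to |V⟩.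
w : ℕ → Row → ℚ
w h τ = Σ[ rows (length τ) ] (λ b → ind (ok h τ b))

pred-or-0 : (ℕ → ℚ) → ℕ → ℚ
pred-or-0 F zero = 0ℚ
pred-or-0 F (suc k) = F k

w-black : ∀ h r → w h (true ∷ r) ≡ w (suc h) r + w h r
w-black h r = trans (Σ-rows (length r) (λ b → ind (ok h (true ∷ r) b)))
  (Σ-+ (rows (length r)) (λ b → ind (ok (suc h) r b)) (λ b → ind (ok h r b)))

w-white : ∀ h r → w h (false ∷ r) ≡ w h r + pred-or-0 (λ h → w h r) h
w-white zero r = trans (Σ-rows (length r) (λ b → ind (ok 0 (false ∷ r) b)))
  (trans (Σ-+ (rows (length r)) (λ b → ind (ok 0 r b)) (λ _ → 0ℚ)) (cong (w 0 r +_) (Σ-0 (rows (length r)))))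
w-white (suc h) r = trans (Σ-rows (length r) (λ b → ind (ok (suc h) (false ∷ r) b)))
  (Σ-+ (rows (length r)) (λ b → ind (ok (suc h) r b)) (λ b → ind (ok h r b)))

w-left : ∀ r → w 0 (false ∷ r) ≡ w 0 r
w-left r = trans (w-white 0 r) (ℚP.+-identityʳ (w 0 r))

-- After the rise the fall is never forbidden, so `w-white` is used at height h + 1 with both terms
-- present; the four resulting terms regroup as D + E.
w-bulk : ∀ h r → w h (true ∷ false ∷ r) ≡ w h (true ∷ r) + w h (false ∷ r)
w-bulk h r = trans (w-black h (false ∷ r)) (trans (cong₂ _+_ (w-white (suc h) r) (w-white h r))
  (sym (trans (cong₂ _+_ (w-black h r) (w-white h r)) refl)))

w-ansatz : ∀ h → Ansatz (w h)
w-ansatz h .bulk p r = go h p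
  where
  go : ∀ h p → w h (p ++ true ∷ false ∷ r) ≡ w h (p ++ true ∷ r) + w h (p ++ false ∷ r)
  go h [] = w-bulk h r
  go h (true ∷ p) = trans (w-black h (p ++ true ∷ false ∷ r)) (trans (cong₂ _+_ (go (suc h) p) (go h p))
    (trans (+-interchange (w (suc h) (p ++ true ∷ r)) (w (suc h) (p ++ false ∷ r)) (w h (p ++ true ∷ r)) (w h (p ++ false ∷ r)))
      (sym (cong₂ _+_ (w-black h (p ++ true ∷ r)) (w-black h (p ++ false ∷ r))))))
  go zero (false ∷ p) = trans (w-left (p ++ true ∷ false ∷ r)) (trans (go 0 p)
    (sym (cong₂ _+_ (w-left (p ++ true ∷ r)) (w-left (p ++ false ∷ r)))))
  go (suc h) (false ∷ p) = trans (w-white (suc h) (p ++ true ∷ false ∷ r)) (trans (cong₂ _+_ (go (suc h) p) (go h p))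
    (trans (+-interchange (w (suc h) (p ++ true ∷ r)) (w (suc h) (p ++ false ∷ r)) (w h (p ++ true ∷ r)) (w h (p ++ false ∷ r)))
      (sym (cong₂ _+_ (w-white (suc h) (p ++ true ∷ r)) (w-white (suc h) (p ++ false ∷ r))))))
w-ansatz h .right p = go h p
  where
  go : ∀ h p → w h (p ++ true ∷ []) ≡ w h p
  -- Rising in the last column would end above height 0: `w (suc h) []` computes to zero.
  go h [] = trans (w-black h []) (ℚP.+-identityˡ (w h []))
  go h (true ∷ p) = trans (w-black h (p ++ true ∷ [])) (trans (cong₂ _+_ (go (suc h) p) (go h p)) (sym (w-black h p)))
  go zero (false ∷ p) = trans (w-left (p ++ true ∷ [])) (trans (go 0 p) (sym (w-left p)))
  go (suc h) (false ∷ p) = trans (w-white (suc h) (p ++ true ∷ [])) (trans (cong₂ _+_ (go (suc h) p) (go h p)) (sym (w-white (suc h) p)))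

w-≥0 : ∀ h τ → 0ℚ ≤ w h τ
w-≥0 h τ = Σ-nonNeg (rows (length τ)) (λ b _ → 0≤ind (ok h τ b))

-- Only the all-black bottom row keeps the walk nonnegative. This single weight makes the
-- normalising constant positive.
w-all-white : ∀ n → w 0 (replicate n false) ≡ 1ℚ
w-all-white zero = refl
w-all-white (suc n) = trans (w-left (replicate n false)) (w-all-white n)

count-top : ∀ n (p : Row → Bool) →
  ℕtoℚ (length (boolFilter (p ∘ top) (Ω n))) ≡ Σ[ rows n ] (λ τ → w 0 τ * ind (p τ))
count-top n p = trans (length-filter (p ∘ top) (Ω n)) (trans (Σ-Ω n (ind ∘ p ∘ top))
  (Σ-cong-∈ (rows n) (λ t t∈ → trans (Σ-*ʳ (rows n) (ind (p t)) (λ b → ind (ok 0 t b)))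
    (cong (λ m → Σ[ rows m ] (λ b → ind (ok 0 t b)) * ind (p t)) (sym (∈-rows⁻ n t∈))))))

length-Ω : ∀ n → ℕtoℚ (length (Ω n)) ≡ Σ[ rows n ] (w 0)
length-Ω n = trans (cong (ℕtoℚ ∘ length) (sym (filter-true (Ω n)))) (trans (count-top n (λ _ → true))
  (Σ-cong (rows n) (λ τ → ℚP.*-identityʳ (w 0 τ))))
  where
  filter-true : (xs : List A) → boolFilter (λ _ → true) xs ≡ xs
  filter-true [] = refl
  filter-true (x ∷ xs) = cong (x ∷_) (filter-true xs)

Ω-nonempty : ∀ n → 0ℚ < Σ[ rows n ] (w 0)
Ω-nonempty n = ℚP.<-≤-trans (subst (0ℚ <_) (sym (w-all-white n)) (ℚP.positive⁻¹ 1ℚ))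
  (term≤Σ (rows n) {w 0} (λ τ _ → w-≥0 0 τ) (subst (λ m → replicate n false ∈ rows m) (ListP.length-replicate n) (∈-rows⁺ (replicate n false))))

-- The test function is arbitrary so that the induction can replace it by its average; indicators of
-- rows give the equality of the laws.
top-law : ∀ n → 1 ℕ.≤ n → (μS : Row → ℚ) (μX : Conf → ℚ) →
  ((τ : Row) → τ ∈ rows n → μS τ ≡ topLaw n μX τ) → ∀ t (g : Row → ℚ) →
  Σ[ Ω n ] (λ ω → lawX n 1ℚ 1ℚ 1ℚ μX t ω * g (top ω)) ≡ Σ[ rows n ] (λ τ → lawS n 1ℚ 1ℚ 1ℚ μS t τ * g τ)
top-law n 1≤ μS μX same zero g = sym (begin
  Σ[ rows n ] (λ τ → μS τ * g τ)
    ≡⟨ Σ-cong-∈ (rows n) (λ τ τ∈ → trans (cong (_* g τ) (same τ τ∈)) (sym (Σ-*ʳ (Ω n) (g τ) (λ ω → μX ω * ind (rowEq (top ω) τ))))) ⟩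
  Σ[ rows n ] (λ τ → Σ[ Ω n ] (λ ω → (μX ω * ind (rowEq (top ω) τ)) * g τ))
    ≡⟨ Σ-swap (rows n) (Ω n) (λ τ ω → (μX ω * ind (rowEq (top ω) τ)) * g τ) ⟩
  Σ[ Ω n ] (λ ω → Σ[ rows n ] (λ τ → (μX ω * ind (rowEq (top ω) τ)) * g τ))
    ≡⟨ Σ-cong-∈ (Ω n) (λ ω ω∈ → trans (Σ-cong (rows n) (λ τ → ℚP.*-assoc (μX ω) (ind (rowEq (top ω) τ)) (g τ)))
         (trans (Σ-*ˡ (rows n) (μX ω) (λ τ → ind (rowEq (top ω) τ) * g τ))
           (cong (μX ω *_) (rows-Δ n (top ω) (subst (λ m → top ω ∈ rows m) (proj₁ (∈-Ω⁻ n ω∈)) (∈-rows⁺ (top ω))) g)))) ⟩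
  Σ[ Ω n ] (λ ω → μX ω * g (top ω)) ∎)
  where open ≡-Reasoning
top-law n 1≤ μS μX same (suc t) g = begin
  Σ[ Ω n ] (λ ω → lawX n 1ℚ 1ℚ 1ℚ μX (suc t) ω * g (top ω))
    ≡⟨ stepLaw-dual confEq (Ω n) (Tmap n) n (Ω-Δ n) (Ω-closed n 1≤) (lawX n 1ℚ 1ℚ 1ℚ μX t) (g ∘ top) ⟩
  Σ[ Ω n ] (λ ω → lawX n 1ℚ 1ℚ 1ℚ μX t ω * average (Tmap n) n (g ∘ top) ω)
    ≡⟨ Σ-cong-∈ (Ω n) (λ ω ω∈ → cong (λ s → lawX n 1ℚ 1ℚ 1ℚ μX t ω * ((ℤ.+ 1 / suc n) * s))
         (Σ-cong-∈ (range 0 n) (λ i i∈ → cong g (top-Tmap n 1≤ ω i ω∈ (∈-range⁻ i∈))))) ⟩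
  Σ[ Ω n ] (λ ω → lawX n 1ℚ 1ℚ 1ℚ μX t ω * average (tasepMove n) n g (top ω))
    ≡⟨ top-law n 1≤ μS μX same t (average (tasepMove n) n g) ⟩
  Σ[ rows n ] (λ τ → lawS n 1ℚ 1ℚ 1ℚ μS t τ * average (tasepMove n) n g τ)
    ≡⟨ sym (stepLaw-dual rowEq (rows n) (tasepMove n) n (rows-Δ n) (rows-closed n) (lawS n 1ℚ 1ℚ 1ℚ μS t) g) ⟩
  Σ[ rows n ] (λ τ → lawS n 1ℚ 1ℚ 1ℚ μS (suc t) τ * g τ) ∎
  where open ≡-Reasoning

-- Binomial identities and closed forms of the counts

choose : ℕ → ℕ → ℚ
choose n k = ℕtoℚ (n C k)

pascal : ∀ n k → choose (suc n) (suc k) ≡ choose n k + choose n (suc k)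
pascal n k = trans (cong ℕtoℚ (sym (CP.nCk+nC[k+1]≡[n+1]C[k+1] n k))) (ℕtoℚ-+ (n C k) (n C suc k))

pascal′ : ∀ n k → choose (suc n) k ≡ pred-or-0 (choose n) k + choose n k
pascal′ n zero = refl
pascal′ n (suc k) = pascal n k

-- The reflection-principle count of the walks from height h with k black particles on top.
narayana : ℕ → ℕ → ℕ → ℚ
narayana n k h = choose n k * choose n (h ℕ.+ k) - pred-or-0 (choose n) k * choose n (suc (h ℕ.+ k))

-- Pascal's rule splits both rows of a 2 by 2 determinant, giving four determinants, one for each
-- kind of first column. At h = 0 the one for the forbidden fall has the form xy - yx and vanishes.
narayana-rec : ∀ n k h → narayana (suc n) k h ≡
  pred-or-0 (λ k → narayana n k (suc h) + narayana n k h) k + (narayana n k h + pred-or-0 (narayana n k) h)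
narayana-rec n zero zero = expand (choose (suc n) 1) (choose n 1)
  where
  expand : ∀ x y → 1ℚ * 1ℚ - 0ℚ * x ≡ 0ℚ + ((1ℚ * 1ℚ - 0ℚ * y) + 0ℚ)
  expand = solve-∀ ℚ-ring
narayana-rec n zero (suc h) = trans
  (cong (λ a → 1ℚ * a - 0ℚ * choose (suc n) (suc (suc h ℕ.+ 0))) (pascal n (h ℕ.+ 0)))
  (expand (choose n (h ℕ.+ 0)) (choose n (suc (h ℕ.+ 0))) (choose (suc n) (suc (suc h ℕ.+ 0))) (choose n (suc (suc (h ℕ.+ 0)))))
  where
  expand : ∀ x y z z′ → 1ℚ * (x + y) - 0ℚ * z ≡ 0ℚ + ((1ℚ * y - 0ℚ * z′) + (1ℚ * x - 0ℚ * y))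
  expand = solve-∀ ℚ-ring
narayana-rec n (suc k) zero = trans
  (cong₂ _-_ (cong₂ _*_ (pascal n k) (pascal n k)) (cong₂ _*_ (pascal′ n k) (pascal n (suc k))))
  (expand (pred-or-0 (choose n) k) (choose n k) (choose n (suc k)) (choose n (suc (suc k))))
  where
  expand : ∀ p x y z → (x + y) * (x + y) - (p + x) * (y + z) ≡
    ((x * y - p * z) + (x * x - p * y)) + ((y * y - x * z) + 0ℚ)
  expand = solve-∀ ℚ-ring
narayana-rec n (suc k) (suc h) = subst
  (λ s → choose (suc n) (suc k) * choose (suc n) (suc s) - choose (suc n) k * choose (suc n) (suc (suc s)) ≡
    (narayana n k (suc (suc h)) + narayana n k (suc h)) +
    ((choose n (suc k) * choose n (suc s) - choose n k * choose n (suc (suc s))) + (choose n (suc k) * choose n s - choose n k * choose n (suc s))))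
  (sym (ℕP.+-suc h k))
  (trans (cong₂ _-_ (cong₂ _*_ (pascal n k) (pascal n (suc (h ℕ.+ k)))) (cong₂ _*_ (pascal′ n k) (pascal n (suc (suc (h ℕ.+ k))))))
    (expand (pred-or-0 (choose n) k) (choose n k) (choose n (suc k)) (choose n (suc (h ℕ.+ k))) (choose n (suc (suc (h ℕ.+ k)))) (choose n (suc (suc (suc (h ℕ.+ k)))))))
  where
  expand : ∀ p x y u v s → (x + y) * (u + v) - (p + x) * (v + s) ≡
    ((x * v - p * s) + (x * u - p * v)) + ((y * v - x * s) + (y * u - x * v))
  expand = solve-∀ ℚ-ring

Σ-pred : ∀ (xs : List A) (F : ℕ → A → ℚ) h → Σ[ xs ] (λ x → pred-or-0 (λ h → F h x) h) ≡ pred-or-0 (λ h → Σ[ xs ] (F h)) h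
Σ-pred xs F zero = Σ-0 xs
Σ-pred xs F (suc h) = refl

pred-cong : ∀ {F G : ℕ → ℚ} → (∀ k → F k ≡ G k) → ∀ k → pred-or-0 F k ≡ pred-or-0 G k
pred-cong e zero = refl
pred-cong e (suc k) = e k

pred-* : ∀ (F : ℕ → ℚ) k a → pred-or-0 F k * a ≡ pred-or-0 (λ k → F k * a) k
pred-* F zero a = ℚP.*-zeroˡ a
pred-* F (suc k) a = refl

Σ-w-blacks : ∀ n k h → Σ[ rows n ] (λ τ → w h τ * ind (blacks τ ≡ᵇ k)) ≡ narayana n k h
Σ-w-blacks zero zero zero = refl
Σ-w-blacks zero zero (suc h) = refl
Σ-w-blacks zero (suc k) zero = vanish (choose 0 (0 ℕ.+ suc k)) (choose 0 k)
  where
  vanish : ∀ x y → 0ℚ ≡ 0ℚ * x - y * 0ℚ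
  vanish = solve-∀ ℚ-ring
Σ-w-blacks zero (suc k) (suc h) = vanish (choose 0 (suc h ℕ.+ suc k)) (choose 0 k)
  where
  vanish : ∀ x y → 0ℚ ≡ 0ℚ * x - y * 0ℚ
  vanish = solve-∀ ℚ-ring
Σ-w-blacks (suc n) k h = trans (Σ-rows n (λ τ → w h τ * ind (blacks τ ≡ᵇ k)))
  (trans (Σ-+ (rows n) (λ r → w h (true ∷ r) * ind (suc (blacks r) ≡ᵇ k)) (λ r → w h (false ∷ r) * ind (blacks r ≡ᵇ k)))
    (trans (cong₂ _+_ (black-part k) white-part) (sym (narayana-rec n k h))))
  where
  W : ℕ → ℕ → Row → ℚ
  W k h r = w h r * ind (blacks r ≡ᵇ k)
  black-part : ∀ k → Σ[ rows n ] (λ r → w h (true ∷ r) * ind (suc (blacks r) ≡ᵇ k)) ≡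
    pred-or-0 (λ k → narayana n k (suc h) + narayana n k h) k
  black-part zero = trans (Σ-cong (rows n) (λ r → ℚP.*-zeroʳ (w h (true ∷ r)))) (Σ-0 (rows n))
  black-part (suc k) = trans
    (Σ-cong (rows n) (λ r → trans (cong (_* ind (blacks r ≡ᵇ k)) (w-black h r)) (ℚP.*-distribʳ-+ (ind (blacks r ≡ᵇ k)) (w (suc h) r) (w h r))))
    (trans (Σ-+ (rows n) (W k (suc h)) (W k h)) (cong₂ _+_ (Σ-w-blacks n k (suc h)) (Σ-w-blacks n k h)))
  white-part : Σ[ rows n ] (λ r → w h (false ∷ r) * ind (blacks r ≡ᵇ k)) ≡ narayana n k h + pred-or-0 (narayana n k) h
  white-part = trans
    (Σ-cong (rows n) (λ r → trans (cong (_* ind (blacks r ≡ᵇ k)) (w-white h r))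
      (trans (ℚP.*-distribʳ-+ (ind (blacks r ≡ᵇ k)) (w h r) (pred-or-0 (λ h → w h r) h))
        (cong (W k h r +_) (pred-* (λ h → w h r) h (ind (blacks r ≡ᵇ k)))))))
    (trans (Σ-+ (rows n) (W k h) (λ r → pred-or-0 (λ h → W k h r) h))
      (cong₂ _+_ (Σ-w-blacks n k h) (trans (Σ-pred (rows n) (W k) h) (pred-cong (λ h → Σ-w-blacks n k h) h))))

-- The rule (k + 1) C(n,k+1) = (n - k) C(n,k) without subtraction.
absorption : ∀ n k → ℕtoℚ (suc k) * choose n (suc k) + ℕtoℚ k * choose n k ≡ ℕtoℚ n * choose n k
absorption zero zero = refl
absorption zero (suc k) = vanish (ℕtoℚ (suc (suc k))) (ℕtoℚ (suc k))
  where
  vanish : ∀ x y → x * 0ℚ + y * 0ℚ ≡ 0ℚ * 0ℚ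
  vanish = solve-∀ ℚ-ring
absorption (suc n) zero = trans
  (cong (λ x → 1ℚ * x + 0ℚ * choose (suc n) 0) (pascal n 0))
  (trans (split (choose n 0) (choose n 1) (choose (suc n) 0)) (trans (cong (λ x → choose n 0 + x) (absorption n 0))
    (trans (join (choose n 0) (ℕtoℚ n)) (cong (_* choose n 0) (sym (ℕtoℚ-suc n))))))
  where
  split : ∀ x y z → 1ℚ * (x + y) + 0ℚ * z ≡ x + (1ℚ * y + 0ℚ * x)
  split = solve-∀ ℚ-ring
  join : ∀ x n → x + n * x ≡ (1ℚ + n) * x
  join = solve-∀ ℚ-ring
absorption (suc n) (suc k) = begin
  ℕtoℚ (2 ℕ.+ k) * choose (suc n) (2 ℕ.+ k) + ℕtoℚ (suc k) * choose (suc n) (suc k)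
    ≡⟨ cong₂ _+_ (cong (ℕtoℚ (2 ℕ.+ k) *_) (pascal n (suc k))) (cong (ℕtoℚ (suc k) *_) (pascal n k)) ⟩
  ℕtoℚ (2 ℕ.+ k) * (y + z) + ℕtoℚ (suc k) * (x + y)
    ≡⟨ cong₂ (λ a b → a * (y + z) + b * (x + y)) (trans (ℕtoℚ-suc (suc k)) (cong (1ℚ +_) (ℕtoℚ-suc k))) (ℕtoℚ-suc k) ⟩
  (1ℚ + (1ℚ + κ)) * (y + z) + (1ℚ + κ) * (x + y)
    ≡⟨ regroup x y z κ ⟩
  (((1ℚ + (1ℚ + κ)) * z + (1ℚ + κ) * y) + ((1ℚ + κ) * y + κ * x)) + (x + y)
    ≡⟨ cong (_+ (x + y)) (cong₂ _+_
         (trans (cong₂ (λ a b → a * z + b * y) (sym (trans (ℕtoℚ-suc (suc k)) (cong (1ℚ +_) (ℕtoℚ-suc k)))) (sym (ℕtoℚ-suc k))) (absorption n (suc k)))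
         (trans (cong (λ b → b * y + κ * x) (sym (ℕtoℚ-suc k))) (absorption n k))) ⟩
  (ℕtoℚ n * y + ℕtoℚ n * x) + (x + y)
    ≡⟨ collect x y (ℕtoℚ n) ⟩
  (1ℚ + ℕtoℚ n) * (x + y)
    ≡⟨ cong₂ _*_ (sym (ℕtoℚ-suc n)) (sym (pascal n k)) ⟩
  ℕtoℚ (suc n) * choose (suc n) (suc k) ∎
  where
  open ≡-Reasoning
  x y z κ : ℚ
  x = choose n k
  y = choose n (suc k)
  z = choose n (suc (suc k))
  κ = ℕtoℚ k
  regroup : ∀ x y z κ → (1ℚ + (1ℚ + κ)) * (y + z) + (1ℚ + κ) * (x + y) ≡
    (((1ℚ + (1ℚ + κ)) * z + (1ℚ + κ) * y) + ((1ℚ + κ) * y + κ * x)) + (x + y)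
  regroup = solve-∀ ℚ-ring
  collect : ∀ x y n → (n * y + n * x) + (x + y) ≡ (1ℚ + n) * (x + y)
  collect = solve-∀ ℚ-ring

absorption′ : ∀ n k → ℕtoℚ k * choose n k + ℕtoℚ k * pred-or-0 (choose n) k ≡ (1ℚ + ℕtoℚ n) * pred-or-0 (choose n) k
absorption′ n zero = vanish (choose n 0) (ℕtoℚ n)
  where
  vanish : ∀ x n → 0ℚ * x + 0ℚ * 0ℚ ≡ (1ℚ + n) * 0ℚ
  vanish = solve-∀ ℚ-ring
absorption′ n (suc k) = trans (cong (λ a → ℕtoℚ (suc k) * choose n (suc k) + a * choose n k) (ℕtoℚ-suc k))
  (trans (pull (ℕtoℚ (suc k) * choose n (suc k)) (ℕtoℚ k) (choose n k)) (trans (cong (_+ choose n k) (absorption n k)) (join (ℕtoℚ n) (choose n k))))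
  where
  pull : ∀ a κ x → a + (1ℚ + κ) * x ≡ (a + κ * x) + x
  pull = solve-∀ ℚ-ring
  join : ∀ n x → n * x + x ≡ (1ℚ + n) * x
  join = solve-∀ ℚ-ring

difference-0 : ∀ {a b} → a ≡ b → a - b ≡ 0ℚ
difference-0 {a} refl = ℚP.+-inverseʳ a

-- The difference of both sides is a combination of the two absorption relations at k.
narayana-closed : ∀ n k → ℕtoℚ (suc n) * narayana n k 0 ≡ choose (suc n) k * choose (suc n) (suc k)
narayana-closed n k = begin
  ℕtoℚ (suc n) * (b * b - a * d)
    ≡⟨ cong (_* (b * b - a * d)) (ℕtoℚ-suc n) ⟩
  (1ℚ + ν) * (b * b - a * d)
    ≡⟨ combination a b d κ ν ⟩
  (a + b) * (b + d) + ((b + d) * ((κ * b + κ * a) - (1ℚ + ν) * a) - (a + b) * (((1ℚ + κ) * d + κ * b) - ν * b))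
    ≡⟨ cong ((a + b) * (b + d) +_) (cong₂ (λ x y → (b + d) * x - (a + b) * y)
         (difference-0 (absorption′ n k))
         (difference-0 (trans (cong (λ s → s * d + κ * b) (sym (ℕtoℚ-suc k))) (absorption n k)))) ⟩
  (a + b) * (b + d) + ((b + d) * 0ℚ - (a + b) * 0ℚ)
    ≡⟨ vanish ((a + b) * (b + d)) (a + b) (b + d) ⟩
  (a + b) * (b + d)
    ≡⟨ cong₂ _*_ (sym (pascal′ n k)) (sym (pascal n k)) ⟩
  choose (suc n) k * choose (suc n) (suc k) ∎
  where
  open ≡-Reasoning
  a b d κ ν : ℚ
  a = pred-or-0 (choose n) k
  b = choose n k
  d = choose n (suc k)
  κ = ℕtoℚ k
  ν = ℕtoℚ n
  combination : ∀ a b d κ ν → (1ℚ + ν) * (b * b - a * d) ≡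
    (a + b) * (b + d) + ((b + d) * ((κ * b + κ * a) - (1ℚ + ν) * a) - (a + b) * (((1ℚ + κ) * d + κ * b) - ν * b))
  combination = solve-∀ ℚ-ring
  vanish : ∀ x y z → x + (z * 0ℚ - y * 0ℚ) ≡ x
  vanish = solve-∀ ℚ-ring

-- Each column is read as two unit steps, giving paths of 2n steps from 2h to 0 that avoid -2, a
-- level met only between columns. Reflection at -2 sends the end point 0 to -4, hence the index
-- shift by 2.
ballot : ℕ → ℕ → ℚ
ballot n h = choose (n ℕ.+ n) (h ℕ.+ n) - choose (n ℕ.+ n) (2 ℕ.+ (h ℕ.+ n))

pascal² : ∀ m j → choose (2 ℕ.+ m) (2 ℕ.+ j) ≡ (choose m j + choose m (1 ℕ.+ j)) + (choose m (1 ℕ.+ j) + choose m (2 ℕ.+ j))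
pascal² m j = trans (pascal (suc m) (suc j)) (cong₂ _+_ (pascal m j) (pascal m (suc j)))

pascal²′ : ∀ m j → choose (2 ℕ.+ m) (suc j) ≡ (pred-or-0 (choose m) j + choose m j) + (choose m j + choose m (1 ℕ.+ j))
pascal²′ m j = trans (pascal (suc m) j) (cong₂ _+_ (pascal′ m j) (pascal m j))

-- For `ballot` at h = 0: the forbidden fall would contribute C(2n,n-1) - C(2n,n+1), which this
-- symmetry makes zero.
central-symmetry : ∀ n → pred-or-0 (choose (n ℕ.+ n)) n ≡ choose (n ℕ.+ n) (suc n)
central-symmetry zero = refl
central-symmetry (suc n) = cong ℕtoℚ (trans (CP.nCk≡nC[n∸k] {k = n} {n = suc n ℕ.+ suc n} (ℕP.≤-trans (ℕP.n≤1+n n) (ℕP.m≤m+n (suc n) (suc n))))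
  (cong ((suc n ℕ.+ suc n) C_) (trans (cong (ℕ._∸ n) shift) (ℕP.m+n∸n≡m (2 ℕ.+ n) n))))
  where
  shift : suc n ℕ.+ suc n ≡ 2 ℕ.+ n ℕ.+ n
  shift = cong suc (ℕP.+-suc n n)

suc-double : ∀ n → suc n ℕ.+ suc n ≡ 2 ℕ.+ (n ℕ.+ n)
suc-double n = cong suc (ℕP.+-suc n n)

ballot-suc : ∀ n h → ballot (suc n) h ≡
  choose (2 ℕ.+ (n ℕ.+ n)) (suc (h ℕ.+ n)) - choose (2 ℕ.+ (n ℕ.+ n)) (2 ℕ.+ (suc (h ℕ.+ n)))
ballot-suc n h = cong₂ (λ m j → choose m j - choose m (2 ℕ.+ j)) (suc-double n) (ℕP.+-suc h n)

ballot-rec : ∀ n h → ballot (suc n) h ≡ (ballot n (suc h) + ballot n h) + (ballot n h + pred-or-0 (ballot n) h)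
ballot-rec n zero = trans (ballot-suc n 0)
  (trans (cong₂ _-_ (trans (pascal²′ m n) (cong (λ p → (p + choose m n) + (choose m n + choose m (1 ℕ.+ n))) (central-symmetry n))) (pascal² m (suc n)))
    (expand (choose m n) (choose m (1 ℕ.+ n)) (choose m (2 ℕ.+ n)) (choose m (3 ℕ.+ n))))
  where
  m = n ℕ.+ n
  expand : ∀ x y z u → ((y + x) + (x + y)) - ((y + z) + (z + u)) ≡ ((y - u) + (x - z)) + ((x - z) + 0ℚ)
  expand = solve-∀ ℚ-ring
ballot-rec n (suc h) = trans (ballot-suc n (suc h))
  (trans (cong₂ _-_ (pascal² m s) (pascal² m (2 ℕ.+ s)))
    (expand (choose m s) (choose m (1 ℕ.+ s)) (choose m (2 ℕ.+ s)) (choose m (3 ℕ.+ s)) (choose m (4 ℕ.+ s))))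
  where
  m s : ℕ
  m = n ℕ.+ n
  s = h ℕ.+ n
  expand : ∀ v x y z u → ((v + x) + (x + y)) - ((y + z) + (z + u)) ≡ ((y - u) + (x - z)) + ((x - z) + (v - y))
  expand = solve-∀ ℚ-ring

Σ-w : ∀ n h → Σ[ rows n ] (w h) ≡ ballot n h
Σ-w zero zero = refl
Σ-w zero (suc h) = refl
Σ-w (suc n) h = trans (Σ-rows n (w h)) (trans (Σ-+ (rows n) (λ r → w h (true ∷ r)) (λ r → w h (false ∷ r)))
  (trans (cong₂ _+_
      (trans (Σ-cong (rows n) (w-black h)) (trans (Σ-+ (rows n) (w (suc h)) (w h)) (cong₂ _+_ (Σ-w n (suc h)) (Σ-w n h))))
      (trans (Σ-cong (rows n) (w-white h)) (trans (Σ-+ (rows n) (w h) (λ r → pred-or-0 (λ h → w h r) h))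
        (cong₂ _+_ (Σ-w n h) (trans (Σ-pred (rows n) w h) (pred-cong (Σ-w n) h))))))
    (sym (ballot-rec n h))))

-- The right side is expanded by Pascal's rule twice; the difference of the sides is then a
-- combination of `absorption` in row 2n at n and at n + 1.
ballot-closed : ∀ n → ℕtoℚ (2 ℕ.+ n) * ballot n 0 ≡ choose (2 ℕ.+ (n ℕ.+ n)) (suc n)
ballot-closed n = begin
  ℕtoℚ (2 ℕ.+ n) * (x - z)
    ≡⟨ cong (_* (x - z)) 2+ν ⟩
  (1ℚ + (1ℚ + ν)) * (x - z)
    ≡⟨ combination x y z ν ⟩
  ((y + x) + (x + y)) - ((((1ℚ + ν) * y + ν * x) - (ν + ν) * x) + (((1ℚ + (1ℚ + ν)) * z + (1ℚ + ν) * y) - (ν + ν) * y))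
    ≡⟨ cong₂ (λ u v → ((y + x) + (x + y)) - (u + v))
         (difference-0 (trans (cong (λ s → s * y + ν * x) (sym (ℕtoℚ-suc n))) (trans (absorption m n) (cong (_* x) (ℕtoℚ-+ n n)))))
         (difference-0 (trans (cong₂ (λ s r → s * z + r * y) (sym 2+ν) (sym (ℕtoℚ-suc n))) (trans (absorption m (suc n)) (cong (_* y) (ℕtoℚ-+ n n))))) ⟩
  ((y + x) + (x + y)) - (0ℚ + 0ℚ)
    ≡⟨ vanish ((y + x) + (x + y)) ⟩
  (y + x) + (x + y)
    ≡⟨ cong (λ p → (p + x) + (x + y)) (sym (central-symmetry n)) ⟩
  (pred-or-0 (choose m) n + x) + (x + y)
    ≡⟨ sym (pascal²′ m n) ⟩
  choose (2 ℕ.+ (n ℕ.+ n)) (suc n) ∎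
  where
  open ≡-Reasoning
  m : ℕ
  m = n ℕ.+ n
  x y z ν : ℚ
  x = choose m n
  y = choose m (suc n)
  z = choose m (2 ℕ.+ n)
  ν = ℕtoℚ n
  2+ν : ℕtoℚ (2 ℕ.+ n) ≡ 1ℚ + (1ℚ + ν)
  2+ν = trans (ℕtoℚ-suc (suc n)) (cong (1ℚ +_) (ℕtoℚ-suc n))
  combination : ∀ x y z ν → (1ℚ + (1ℚ + ν)) * (x - z) ≡
    ((y + x) + (x + y)) - ((((1ℚ + ν) * y + ν * x) - (ν + ν) * x) + (((1ℚ + (1ℚ + ν)) * z + (1ℚ + ν) * y) - (ν + ν) * y))
  combination = solve-∀ ℚ-ring
  vanish : ∀ s → s - (0ℚ + 0ℚ) ≡ s
  vanish = solve-∀ ℚ-ring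

-- The limit law

Σ-rowEqʳ : ∀ n (P : Row → ℚ) τ → τ ∈ rows n → Σ[ rows n ] (λ r → P r * ind (rowEq r τ)) ≡ P τ
Σ-rowEqʳ n P τ τ∈ = trans
  (Σ-cong (rows n) (λ r → trans (ℚP.*-comm (P r) (ind (rowEq r τ))) (cong (λ b → ind b * P r) (rowEq-sym r τ))))
  (rows-Δ n τ τ∈ P)

÷'-distrib : ∀ p q → q ≢ 0ℚ → p * (1ℚ ÷' q) ≡ p ÷' q
÷'-distrib p q q≢0 = sym (÷'-unique p q (p * (1ℚ ÷' q)) q≢0
  (trans (ℚP.*-assoc p (1ℚ ÷' q) q) (trans (cong (p *_) (÷'-* 1ℚ q q≢0)) (ℚP.*-identityʳ p))))

1÷'-≥0 : ∀ q → 0ℚ < q → 0ℚ ≤ 1ℚ ÷' q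
1÷'-≥0 q 0<q = ℚP.*-cancelʳ-≤-pos q {{positive 0<q}}
  (subst₂ _≤_ (sym (ℚP.*-zeroˡ q)) (sym (÷'-* 1ℚ q (ℚP.<⇒≢ 0<q ∘ sym))) (0≤ind true))

-- One limit for every event on the top row: equality with a given row and a given number of
-- particles are the two cases of the theorem.
tasep-limit : ∀ n {μ} → IsDistribution (rows (suc n)) μ → (p : Row → Bool) →
  (λ t → Σ[ rows (suc n) ] (λ τ → lawS (suc n) 1ℚ 1ℚ 1ℚ μ t τ * ind (p τ))) ⟶
  (ℕtoℚ (length (boolFilter (p ∘ top) (Ω (suc n)))) ÷' ℕtoℚ (length (Ω (suc n))))
tasep-limit n {μ} μ-dist p = subst ((λ t → Σ[ rows (suc n) ] (λ τ → lawS (suc n) 1ℚ 1ℚ 1ℚ μ t τ * ind (p τ))) ⟶_) value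
  (tasep-converges n {μ} {π} μ-dist (π≥0 , Σπ≡1) invariant {ind ∘ p} (λ τ _ → 0≤ind (p τ) , ind≤1 (p τ)))
  where
  open ≡-Reasoning
  R : List Row
  R = rows (suc n)
  Z inv : ℚ
  Z = Σ[ R ] (w 0)
  inv = 1ℚ ÷' Z
  Z≢0 : Z ≢ 0ℚ
  Z≢0 = ℚP.<⇒≢ (Ω-nonempty (suc n)) ∘ sym
  π : Row → ℚ
  π τ = w 0 τ * inv
  π≥0 : ∀ τ → τ ∈ R → 0ℚ ≤ π τ
  π≥0 τ _ = 0≤* (w-≥0 0 τ) (1÷'-≥0 Z (Ω-nonempty (suc n)))
  Σπ≡1 : Σ[ R ] π ≡ 1ℚ
  Σπ≡1 = trans (Σ-*ʳ R inv (w 0)) (trans (ℚP.*-comm Z inv) (÷'-* 1ℚ Z Z≢0))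
  swap-right : ∀ a b d → (a * b) * d ≡ (a * d) * b
  swap-right = solve-∀ ℚ-ring
  Σ-π : ∀ g → Σ[ R ] (λ τ → π τ * g τ) ≡ Σ[ R ] (λ τ → w 0 τ * g τ) * inv
  Σ-π g = trans (Σ-cong R (λ τ → swap-right (w 0 τ) inv (g τ))) (Σ-*ʳ R inv (λ τ → w 0 τ * g τ))
  invariant : ∀ g → Σ[ R ] (λ τ → π τ * average (tasepMove (suc n)) (suc n) g τ) ≡ Σ[ R ] (λ τ → π τ * g τ)
  invariant g = trans (Σ-π (average (tasepMove (suc n)) (suc n) g))
    (trans (cong (_* inv) (stationary n (w-ansatz 0) w-left g)) (sym (Σ-π g)))
  value : Σ[ R ] (λ τ → π τ * ind (p τ)) ≡ ℕtoℚ (length (boolFilter (p ∘ top) (Ω (suc n)))) ÷' ℕtoℚ (length (Ω (suc n)))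
  value = trans (Σ-π (ind ∘ p)) (trans (÷'-distrib (Σ[ R ] (λ τ → w 0 τ * ind (p τ))) Z Z≢0)
    (sym (cong₂ _÷'_ (count-top (suc n) p) (length-Ω (suc n)))))

⟶-cong : ∀ {p q : ℕ → ℚ} {L} → (∀ t → p t ≡ q t) → p ⟶ L → q ⟶ L
⟶-cong {L = L} e h ε 0<ε = proj₁ (h ε 0<ε) , λ t N≤t → subst (λ x → ∣ x - L ∣ < ε) (e t) (proj₂ (h ε 0<ε) t N≤t)

1/suc-solve : ∀ n {x y} → ℕtoℚ (suc n) * x ≡ y → (ℤ.+ 1 / suc n) * y ≡ x
1/suc-solve n {x} refl = trans (sym (ℚP.*-assoc (ℤ.+ 1 / suc n) (ℕtoℚ (suc n)) x))
  (trans (cong (_* x) (1/suc*suc n)) (ℚP.*-identityˡ x))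

length-Ωkm : ∀ n k m → k ℕ.+ m ≡ n → ℕtoℚ (length (Ωkm n k m)) ≡ narayana n k 0
length-Ωkm n k m e = trans (count-top n (λ τ → (blacks τ ≡ᵇ k) ∧ (whites τ ≡ᵇ m)))
  (trans (Σ-cong-∈ (rows n) (λ τ τ∈ → cong (λ b → w 0 τ * ind b) (blacks-suffice τ (∈-rows⁻ n τ∈)))) (Σ-w-blacks n k 0))
  where
  blacks-suffice : ∀ τ → length τ ≡ n → (blacks τ ≡ᵇ k) ∧ (whites τ ≡ᵇ m) ≡ (blacks τ ≡ᵇ k)
  blacks-suffice τ l = ≡-from-T (λ h → proj₁ (Equivalence.to BoolP.T-∧ h)) (λ h → Equivalence.from BoolP.T-∧
    (h , ℕP.≡⇒≡ᵇ (whites τ) m (ℕP.+-cancelˡ-≡ k (whites τ) m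
      (trans (cong (ℕ._+ whites τ) (sym (ℕP.≡ᵇ⇒≡ (blacks τ) k h))) (trans (blacks+whites τ) (trans l (sym e)))))))

narayana-formula : ∀ n k m → k ℕ.+ m ≡ n →
  (ℤ.+ 1 / suc n) * ℕtoℚ (((n ℕ.+ 1) C k) ℕ.* ((n ℕ.+ 1) C m)) ≡ narayana n k 0
narayana-formula n k m e = 1/suc-solve n (trans (narayana-closed n k)
  (trans (cong (λ j → choose (suc n) k * ℕtoℚ j) (sym symmetric))
    (trans (sym (ℕtoℚ-* (suc n C k) (suc n C m))) (cong (λ N → ℕtoℚ ((N C k) ℕ.* (N C m))) (ℕP.+-comm 1 n)))))
  where
  -- Since k + m = n, the numbers m and k + 1 are complementary in n + 1.
  symmetric : suc n C m ≡ suc n C suc k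
  symmetric = trans (CP.nCk≡nC[n∸k] {k = m} {n = suc n} (ℕP.m≤n⇒m≤1+n (subst (m ℕ.≤_) e (ℕP.m≤n+m m k))))
    (cong (suc n C_) (trans (cong (λ j → suc j ℕ.∸ m) (sym e)) (ℕP.m+n∸n≡m (suc k) m)))

catalan-formula : ∀ n → catalanSucc n ≡ ballot n 0
catalan-formula n = 1/suc-solve (suc n) (trans (ballot-closed n)
  (cong₂ (λ a b → choose a b) (double n) (ℕP.+-comm 1 n)))
  where
  double : ∀ n → 2 ℕ.+ (n ℕ.+ n) ≡ 2 ℕ.* n ℕ.+ 2
  double = ℕRing.solve-∀

theorem3 : (n : ℕ) → 1 ℕ.≤ n →
    (μS : Row → ℚ) (μX : Conf → ℚ) →
    IsDistribution (rows n) μS →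
    IsDistribution (Ω n) μX →
    ((τ : Row) → τ ∈ rows n → μS τ ≡ topLaw n μX τ) →
    ((τ : Row) → τ ∈ rows n →
    ((t : ℕ) → lawS n 1ℚ 1ℚ 1ℚ μS t τ ≡ topLaw n (lawX n 1ℚ 1ℚ 1ℚ μX t) τ)
    × ((λ t → lawS n 1ℚ 1ℚ 1ℚ μS t τ)
    ⟶ (ℕtoℚ (length (boolFilter (λ ω → rowEq (top ω) τ) (Ω n))) ÷' ℕtoℚ (length (Ω n)))))
    × ((k m : ℕ) → k ℕ.+ m ≡ n →
    ((λ t → Σ[ rows n ] (λ τ → lawS n 1ℚ 1ℚ 1ℚ μS t τ
    * ind ((blacks τ ≡ᵇ k) ∧ (whites τ ≡ᵇ m))))
    ⟶ (ℕtoℚ (length (Ωkm n k m)) ÷' ℕtoℚ (length (Ω n))))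
    × (ℕtoℚ (length (Ωkm n k m)) ÷' ℕtoℚ (length (Ω n))
    ≡ ((ℤ.+ 1 / suc n) * ℕtoℚ (((n ℕ.+ 1) C k) ℕ.* ((n ℕ.+ 1) C m))) ÷' catalanSucc n))
theorem3 zero ()
theorem3 (suc n) 1≤n μS μX μS-dist μX-dist same =
  (λ τ τ∈ →
    (λ t → trans (sym (Σ-rowEqʳ (suc n) (lawS (suc n) 1ℚ 1ℚ 1ℚ μS t) τ τ∈))
      (sym (top-law (suc n) 1≤n μS μX same t (λ r → ind (rowEq r τ))))) ,
    ⟶-cong (λ t → Σ-rowEqʳ (suc n) (lawS (suc n) 1ℚ 1ℚ 1ℚ μS t) τ τ∈) (tasep-limit n μS-dist (λ r → rowEq r τ))) ,
  (λ k m k+m≡n →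
    tasep-limit n μS-dist (λ τ → (blacks τ ≡ᵇ k) ∧ (whites τ ≡ᵇ m)) ,
    cong₂ _÷'_ (trans (length-Ωkm (suc n) k m k+m≡n) (sym (narayana-formula (suc n) k m k+m≡n)))
      (trans (length-Ω (suc n)) (trans (Σ-w (suc n) 0) (sym (catalan-formula (suc n))))))
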